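{- Let $n\geq 3$ and $k=\binom{n}{2}-t$ with $0\leq t\leq\frac13(n-1)^2$. (i) If $t$ is even, then $M(k,n)=\binom{n}{2}-\frac12 t$, and the extremal multiset of subgraphs is $\{t/2 * K_3,\ (\binom{n}{2}-3t/2) * K_2\}$. (ii) If $t$ is odd, then $M(k,n)=\binom{n}{2}-\frac12(t+1)+\frac13$, and the extremal multiset of subgraphs is $\{(t-1)/2 * K_3,\ (\binom{n}{2}-2-3(t-1)/2) * K_2,\ 1 * P_3\}$.
   Context: For a finite graph $G$, $\mathrm{Mad}(G)=\max\{2e(H)/|V(H)| : H\subseteq G,\ |V(H)|\geq 1\}$. $M(k,n)$ is the maximum of $\sum_{i=1}^k\mathrm{Mad}(G_i)$ over all partitions of $E(K_n)$ into $k$ spanning subgraphs $G_1,\dots,G_k$. The notation $\{t_1*H_1,\dots,t_s*H_s\}$ denotes the multiset with $t_i$ copies of $H_i$; the "extremal multiset of subgraphs" is the multiset of (isolated-vertex-free) graphs forming an edge decomposition of $K_n$ attaining $M(k,n)$. $P_3$ is the path with 3 vertices. -}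

module Defs where

open import Data.Nat as ℕ using (ℕ; zero; suc; _∸_)
open import Data.Fin using (Fin; zero; suc; _<_)
open import Data.Fin.Properties using (_<?_; _≟_)
open import Data.Bool using (Bool; true; false; if_then_else_)
open import Data.Integer using (+_)
open import Data.Rational as ℚ using (ℚ; 0ℚ; _/_)
open import Data.Product using (Σ; Σ-syntax; ∃; ∃-syntax; _×_; _,_)
open import Data.Sum using (_⊎_)
open import Relation.Nullary using (¬_; yes; no)
open import Relation.Nullary.Decidable using (⌊_⌋)
open import Relation.Binary.PropositionalEquality using (_≡_)

Edge : ℕ → Set
Edge n = Σ[ u ∈ Fin n ] Σ[ v ∈ Fin n ] (u < v)

Graph : ℕ → Set
Graph n = Edge n → Bool

count : ∀ {m} → (Fin m → Bool) → ℕ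
count {zero}  P = 0
count {suc m} P = (if P zero then 1 else 0) ℕ.+ count (λ i → P (suc i))

countEdges : ∀ {n} → (Edge n → Bool) → ℕ
countEdges {n} F = go-u
  where
  row : Fin n → ℕ
  row u = count (λ v → test u v)
    where
    test : Fin n → Fin n → Bool
    test u v with u <? v
    ... | yes p = F (u , v , p)
    ... | no _  = false
  go-u : ℕ
  go-u = count' row
    where
    count' : ∀ {m} → (Fin m → ℕ) → ℕ
    count' {zero}  f = 0
    count' {suc m} f = f zero ℕ.+ count' (λ i → f (suc i))

record Subgraph {n : ℕ} (G : Graph n) : Set where
  field
    S       : Fin n → Bool
    F       : Edge n → Bool
    nonempty : ∃[ x ] (S x ≡ true)
    F⊆G     : ∀ (u v : Fin n) (p : u < v) → F (u , v , p) ≡ true →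
                G (u , v , p) ≡ true × S u ≡ true × S v ≡ true

-- 2 e / v as a rational (v = 0 never occurs for nonempty subgraphs)
ratio : ℕ → ℕ → ℚ
ratio e zero    = 0ℚ
ratio e (suc v) = (+ (2 ℕ.* e)) / suc v

density : ∀ {n} {G : Graph n} → Subgraph G → ℚ
density H = ratio (countEdges (Subgraph.F H)) (count (Subgraph.S H))

IsMad : ∀ {n} → Graph n → ℚ → Set
IsMad G m = (∃[ H ] (density {G = G} H ≡ m)) × (∀ (H : Subgraph G) → density H ℚ.≤ m)

part : ∀ {n k} → (Edge n → Fin k) → Fin k → Graph n
part c i e = ⌊ c e ≟ i ⌋

sumℚ : ∀ {k} → (Fin k → ℚ) → ℚ
sumℚ {zero}  f = 0ℚ
sumℚ {suc k} f = f zero ℚ.+ sumℚ (λ i → f (suc i))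

MadSum : ∀ {n k} → (Edge n → Fin k) → (Fin k → ℚ) → Set
MadSum {k = k} c m = ∀ (i : Fin k) → IsMad (part c i) (m i)

IsM : ℕ → ℕ → ℚ → Set
IsM k n μ =
  (∃[ c ] ∃[ m ] (MadSum {n} {k} c m × sumℚ m ≡ μ)) ×
  (∀ (c : Edge n → Fin k) (m : Fin k → ℚ) → MadSum c m → sumℚ m ℚ.≤ μ)

Extremal : ∀ {n k} → ℚ → (Edge n → Fin k) → Set
Extremal μ c = ∃[ m ] (MadSum c m × sumℚ m ≡ μ)

SameEdge : ∀ {n} → Fin n → Fin n → Fin n → Fin n → Set
SameEdge u v a b = (u ≡ a × v ≡ b) ⊎ (u ≡ b × v ≡ a)

_⇔_ : Set → Set → Set
A ⇔ B = (A → B) × (B → A)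

-- G, with isolated vertices removed, is isomorphic to K_2: a single edge ab.
IsK2 : ∀ {n} → Graph n → Set
IsK2 G = ∃[ a ] ∃[ b ] (¬ a ≡ b ×
  (∀ u v (p : u < v) → (G (u , v , p) ≡ true) ⇔ SameEdge u v a b))

-- G, with isolated vertices removed, is isomorphic to K_3: edges ab, bc, ac.
IsK3 : ∀ {n} → Graph n → Set
IsK3 G = ∃[ a ] ∃[ b ] ∃[ c ] (¬ a ≡ b × ¬ b ≡ c × ¬ a ≡ c ×
  (∀ u v (p : u < v) → (G (u , v , p) ≡ true) ⇔
     (SameEdge u v a b ⊎ SameEdge u v b c ⊎ SameEdge u v a c)))

-- G, with isolated vertices removed, is isomorphic to P_3: path a - b - c.
IsP3 : ∀ {n} → Graph n → Set
IsP3 G = ∃[ a ] ∃[ b ] ∃[ c ] (¬ a ≡ b × ¬ b ≡ c × ¬ a ≡ c ×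
  (∀ u v (p : u < v) → (G (u , v , p) ≡ true) ⇔
     (SameEdge u v a b ⊎ SameEdge u v b c)))

data Shape : Set where
  k2 k3 p3 : Shape

HasShape : ∀ {n} → Graph n → Shape → Set
HasShape G k2 = IsK2 G
HasShape G k3 = IsK3 G
HasShape G p3 = IsP3 G

isK2 isK3 isP3 : Shape → Bool
isK2 k2 = true
isK2 _  = false
isK3 k3 = true
isK3 _  = false
isP3 p3 = true
isP3 _  = false

-- The multiset of (isolated-vertex-free) parts of c is
-- { a * K_3, b * K_2, d * P_3 } (up to isomorphism).
PartsMultiset : ∀ {n k} → (Edge n → Fin k) → ℕ → ℕ → ℕ → Set
PartsMultiset {k = k} c a b d = Σ[ σ ∈ (Fin k → Shape) ] (
  (∀ (i : Fin k) → HasShape (part c i) (σ i)) ×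
  count (λ i → isK3 (σ i)) ≡ a ×
  count (λ i → isK2 (σ i)) ≡ b ×
  count (λ i → isP3 (σ i)) ≡ d)

{-# OPTIONS --safe #-}
module Submission where

-- A densest subgraph with v vertices and e edges of a graph with E ≥ e edges has 2e/v ≤ (E + 1)/2,
-- with equality only for K₂ and K₃; the deficit is 1/6 for P₃ and at least 1/2 for every other graph.
-- Summed over the k parts this bounds the Mad sum by (N + k)/2 with N = n C 2, and when t = N − k is
-- odd some part has an even number of edges, so at least 1/6 is lost. Hence the theorem reduces to
-- finding s edge-disjoint triangles in K_n whenever 6s ≤ (n − 1)² (for odd t, the more than n/2 edges
-- left over cannot form a matching, which gives the P₃).
--
-- The packings are of Bose–Skolem type. Let n = 3q + j with points (i, x), i ∈ ℤ/3, x < q, and j points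
-- at infinity, and let ∙ be the commutative quasigroup x ∙ y = (x + y)/2 on q elements. The triangles
-- (i, x) (i, y) (i + 1, x ∙ y), x ≠ y, leave only the edges (i, x) (i + 1, x ∙ x) and those at infinity,
-- from which columns and triangles with an apex at infinity are chosen according to n mod 6.
-- For n = 6k + 2 one vertex of the system for 6k + 3 is deleted.

open import Defs
open import Data.Nat using (ℕ; zero; suc; _≤_; _<_; s≤s; z≤n; s≤s⁻¹; _*_; _∸_; _^_; _+_; _≤?_; _<?_)
import Data.Nat.Properties as ℕ
open import Data.Nat.Properties using (+-0-commutativeMonoid)
open import Data.Nat.Combinatorics using (_C_; nC1≡n; nCk+nC[k+1]≡[n+1]C[k+1])
open import Data.Nat.DivMod using (_divMod_; result)
open import Data.Nat.Solver using (module +-*-Solver)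
open +-*-Solver using (solve; _:*_; _:+_; _:=_; con)
open import Algebra.Properties.CommutativeMonoid.Sum +-0-commutativeMonoid using (sum; sum-cong-≗; ∑-distrib-+)
open import Data.Bool using (Bool; true; false; if_then_else_)
import Data.Bool.Properties as Bool
open import Data.Integer using (+_; +≤+)
import Data.Integer as ℤ
import Data.Integer.Properties as ℤ
open import Data.Rational using (ℚ; _/_)
import Data.Rational as ℚ
import Data.Rational.Properties as ℚ
open import Data.Rational.Unnormalised using (mkℚᵘ; *≤*; *≡*)
import Data.Rational.Unnormalised as ℚᵘ
import Data.Rational.Unnormalised.Properties as ℚᵘ
open import Data.Fin using (Fin; zero; suc)
open import Data.Fin.Patterns using (0F; 1F; 2F; 3F; 4F; 5F)
import Data.Fin as Fin
import Data.Fin.Properties as Fin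
open import Data.List using (List; []; _∷_; _++_; length; lookup; filter; concatMap; map; take; drop; allFin; tabulate)
open import Data.List using (cartesianProductWith; cartesianProduct)
import Data.List.Properties as List
open import Data.List.Membership.Propositional using (_∈_; _∉_; find; lose)
open import Data.List.Membership.Propositional.Properties
open import Data.List.Relation.Unary.Any as Any using (Any; here; there)
open import Data.List.Relation.Unary.Any.Properties using (lookup-index)
open import Data.List.Relation.Unary.All as All using (All; []; _∷_)
import Data.List.Relation.Unary.All.Properties as All
open import Data.List.Relation.Unary.AllPairs using ([]; _∷_)
open import Data.List.Relation.Unary.Unique.Propositional using (Unique)
import Data.List.Relation.Unary.Unique.Propositional.Properties as Unique
open import Data.List.Relation.Binary.Subset.Propositional using (_⊆_)
open import Data.Product using (Σ; ∃; _×_; _,_; proj₁; proj₂)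
open import Data.Sum using (_⊎_; inj₁; inj₂)
open import Data.Unit using (⊤; tt)
open import Data.Empty using (⊥; ⊥-elim)
open import Function using (_∘_; id; case_of_)
open import Relation.Nullary using (Dec; yes; no; does; contradiction)
open import Relation.Nullary.Decidable using (⌊_⌋; isYes≗does; from-yes; ¬?)
open import Relation.Binary using (tri<; tri≈; tri>)
open import Relation.Binary.PropositionalEquality using (_≡_; _≢_; refl; sym; trans; cong; cong₂; subst; subst₂; module ≡-Reasoning)
open import Tactic.Cong using (cong!)

-- The upper bound and the uniqueness come out of one count. If the total loss is at most 1/6, then
-- every part is K₂, K₃ or P₃, and with a triangles and d paths the edges outnumber the parts by 2a
-- + d = t. Since d ≤ 1, the parity of t fixes d and a, and the number of parts fixes the rest. So a
-- loss below the claimed one is impossible, and an equal loss forces the claimed multiset.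
--
-- The packings must reach every s ≤ ⌊(n - 1)²/6⌋. The constructions give exactly that many
-- triangles when n is 0, 1 or 4 modulo 6, and the estimate for the deleted vertex gives exactly
-- that many when n is 2 modulo 6; there is spare room only for 3 and 5.
--
-- Edge-disjointness is never checked by comparing two triangles. Each edge receives a name from
-- which the only triangle that may contain it is computed, so every triangle is checked by itself
-- against this function.

private variable
  A B : Set
  n k : ℕ

-- Counting edges by lists

-- countEdges adds its rows with a function local to its definition, which has no name here; the
-- module recovers it as the solution of a metavariable. In the unrolled count of a complete graph,
-- cong! abstracts the vertices 0 and 1 of two corresponding entries, which gives the entry at a
-- variable vertex; abstracting the remaining rows by `with` then leaves the local function applied
-- to a variable. The absurd 0 ≡ 1 is only there to be an argument of cong!.
module HiddenSum where

  data Congruence {A B : Set} {x y : A} (p : x ≡ y) : {l r : B} → l ≡ r → Set where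
    by : (f : A → B) → Congruence p (cong f p)

  function : {x y : A} {p : x ≡ y} {l r : B} {q : l ≡ r} → Congruence p q → A → B
  function (by f) = f

  generalise : ∀ (n : ℕ) {c : ℕ} {g₀ g₁ : Fin n → Bool} {x : ℕ} →
    x ≡ suc (suc (count {n} g₀ + suc (count {n} g₁ + c))) →
    (v : Fin n) {a b : A} (p : a ≡ b) (q : g₀ v ≡ g₁ v) → Congruence p q → A → Bool
  generalise _ _ _ _ _ = function

  ZeroIsOne : ℕ → Set
  ZeroIsOne n = Fin.zero {2 + n} ≡ suc zero

  test : ∀ n → ZeroIsOne n → Fin n → Fin (3 + n) → Bool
  test n p v = generalise n {x = countEdges {3 + n} (λ _ → true)} refl v p (cong! p) (by _)

  data Unrolled : ℕ → Set where
    unrolled : ∀ n c → Unrolled (suc (suc (count {n} (λ _ → true) +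
      suc (count {n} (λ _ → true) + (count {n} (λ _ → true) + c)))))

  mutual
    hiddenSum : ∀ n → (Fin n → ℕ) → ℕ
    hiddenSum n f = _

    unroll : ∀ n → ZeroIsOne n → Unrolled (countEdges {3 + n} (λ _ → true))
    unroll n p with (λ (i : Fin n) → count {n} (λ v → test n p v (suc (suc (suc i)))))
    ... | f = unrolled n (hiddenSum n f)

  hiddenSum≡sum : ∀ n f → hiddenSum n f ≡ sum f
  hiddenSum≡sum zero    f = refl
  hiddenSum≡sum (suc n) f = cong (_+_ (f zero)) (hiddenSum≡sum n _)

  mutual
    -- Unification reads it off from the unfolding of `countEdges F` in the type of
    -- `countEdges≡sum`.
    entry : Graph n → Fin n → Fin n → Bool
    entry F u v = _

    countEdges≡sum : ∀ {n} (F : Graph n) → countEdges F ≡ sum (λ u → count (entry F u))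
    countEdges≡sum {n} F = hiddenSum≡sum n _

indicator : Bool → ℕ
indicator b = if b then 1 else 0

select : (A → Bool) → List A → List A
select P = filter (λ x → P x Bool.≟ true)

length-select-∷ : ∀ (P : A → Bool) x xs →
  length (select P (x ∷ xs)) ≡ indicator (P x) + length (select P xs)
length-select-∷ P x xs with P x
... | true  = refl
... | false = refl

length-select-++ : ∀ (P : A → Bool) xs ys →
  length (select P (xs ++ ys)) ≡ length (select P xs) + length (select P ys)
length-select-++ P xs ys =
  trans (cong length (List.filter-++ _ xs ys)) (List.length-++ (select P xs))

count-tabulate : ∀ {m} (P : A → Bool) (f : Fin m → A) →
  count (P ∘ f) ≡ length (select P (tabulate f))
count-tabulate {m = zero}  P f = refl
count-tabulate {m = suc m} P f =
  trans (cong (_+_ (indicator (P (f zero)))) (count-tabulate P (f ∘ suc)))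
        (sym (length-select-∷ P _ _))

count≡length : ∀ {m} (P : Fin m → Bool) → count P ≡ length (select P (allFin m))
count≡length P = count-tabulate P id

count≡sum : ∀ {m} (P : Fin m → Bool) → count P ≡ sum (indicator ∘ P)
count≡sum {zero}  P = refl
count≡sum {suc m} P = cong (_+_ (indicator (P zero))) (count≡sum (P ∘ suc))

length-select-concatMap : ∀ (P : B → Bool) (g : A → List B) {m} (f : Fin m → A) →
  length (select P (concatMap g (tabulate f))) ≡ sum (λ i → length (select P (g (f i))))
length-select-concatMap P g {zero}  f = refl
length-select-concatMap P g {suc m} f =
  trans (length-select-++ P (g (f zero)) _)
        (cong (_+_ (length (select P (g (f zero))))) (length-select-concatMap P g (f ∘ suc)))

edgeList : (u v : Fin n) → List (Edge n)
edgeList u v with u Fin.<? v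
... | yes p = (u , v , p) ∷ []
... | no  _ = []

edges : ∀ n → List (Edge n)
edges n = concatMap (λ u → concatMap (edgeList u) (allFin n)) (allFin n)

edgesOf : Graph n → List (Edge n)
edgesOf {n} G = select G (edges n)

indicator-entry : ∀ (F : Graph n) u v →
  indicator (HiddenSum.entry F u v) ≡ length (select F (edgeList u v))
indicator-entry F u v with u Fin.<? v
... | yes p = sym (trans (length-select-∷ F (u , v , p) []) (ℕ.+-identityʳ _))
... | no  _ = refl

countEdges≡length : (F : Graph n) → countEdges F ≡ length (edgesOf F)
countEdges≡length {n} F = begin
  countEdges F                                                  ≡⟨ HiddenSum.countEdges≡sum F ⟩
  sum (λ u → count (HiddenSum.entry F u))                       ≡⟨ sum-cong-≗ row ⟩
  sum (λ u → length (select F (concatMap (edgeList u) (allFin n))))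
    ≡⟨ length-select-concatMap F (λ u → concatMap (edgeList u) (allFin n)) {n} id ⟨
  length (edgesOf F)                                            ∎
  where
  open ≡-Reasoning
  row : ∀ u → count (HiddenSum.entry F u) ≡ length (select F (concatMap (edgeList u) (allFin n)))
  row u = trans (count≡sum (HiddenSum.entry F u)) (trans (sum-cong-≗ (indicator-entry F u))
            (sym (length-select-concatMap F (edgeList u) {n} id)))

-- A common element of two blocks would have two owners. This replaces the pairwise comparison of
-- blocks, for the list of all edges and later for the triangle packings.
Unique-concatMap : ∀ {f : A → List B} {xs} (owner : B → A) → Unique xs → (∀ x → Unique (f x)) →
  (∀ {x y} → x ∈ xs → y ∈ f x → owner y ≡ x) → Unique (concatMap f xs)
Unique-concatMap {xs = []}     owner _           _  _   = []
Unique-concatMap {f = f} {x ∷ xs} owner (x∉ ∷ xs!) f! own =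
  Unique.++⁺ (f! x) (Unique-concatMap owner xs! f! (own ∘ there)) λ (y∈x , y∈xs) →
    case find (∈-concatMap⁻ f {xs = xs} y∈xs) of λ (x′ , x′∈xs , y∈x′) →
      All.lookup x∉ x′∈xs (trans (sym (own (here refl) y∈x)) (own (there x′∈xs) y∈x′))

∉⇒Unique-∷ : ∀ {x : A} {xs} → x ∉ xs → Unique xs → Unique (x ∷ xs)
∉⇒Unique-∷ x∉ xs! = All.tabulate (λ y∈ x≡y → x∉ (subst (_∈ _) (sym x≡y) y∈)) ∷ xs!

length-Unique-⊆ : ∀ {xs ys : List A} → Unique xs → xs ⊆ ys → length xs ≤ length ys
length-Unique-⊆ {xs = []}     {ys} []         sub = z≤n
length-Unique-⊆ {xs = x ∷ xs} {ys} (x∉ ∷ xs!) sub with ∈-∃++ (sub (here refl))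
... | ys₁ , ys₂ , refl = subst (suc (length xs) ≤_) (sym (List.length-++-sucʳ ys₁ x ys₂))
    (s≤s (length-Unique-⊆ xs! sub′))
  where
  sub′ : xs ⊆ ys₁ ++ ys₂
  sub′ y∈ with ∈-++⁻ ys₁ (sub (there y∈))
  ... | inj₁ y∈₁         = ∈-++⁺ˡ y∈₁
  ... | inj₂ (here refl) = contradiction refl (All.lookup x∉ y∈)
  ... | inj₂ (there y∈₂) = ∈-++⁺ʳ ys₁ y∈₂

-- An element of `ys` missing from `xs` could be put in front of `xs`, and the result would be too
-- long for `ys`.
≤-length⇒⊇ : ∀ (_≟_ : ∀ (x y : A) → Dec (x ≡ y)) {xs ys : List A} →
  Unique xs → xs ⊆ ys → length ys ≤ length xs → ys ⊆ xs
≤-length⇒⊇ _≟_ {xs} {ys} xs! sub len {y} y∈ with Any.any? (y ≟_) xs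
... | yes y∈xs = y∈xs
... | no  y∉xs = contradiction len (ℕ.<⇒≱ (length-Unique-⊆ (∉⇒Unique-∷ y∉xs xs!)
    λ { (here refl) → y∈ ; (there z∈) → sub z∈ }))

Edge-≡ : {e f : Edge n} → proj₁ e ≡ proj₁ f → proj₁ (proj₂ e) ≡ proj₁ (proj₂ f) → e ≡ f
Edge-≡ {e = u , v , p} {_ , _ , q} refl refl = cong (λ r → u , v , r) (ℕ.<-irrelevant p q)

_≟ᴱ_ : (e f : Edge n) → Dec (e ≡ f)
(u , v , p) ≟ᴱ (u′ , v′ , p′) with u Fin.≟ u′ | v Fin.≟ v′
... | yes refl | yes refl = yes (Edge-≡ refl refl)
... | no u≢    | _        = no λ { refl → u≢ refl }
... | yes _    | no v≢    = no λ { refl → v≢ refl }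

∈-edgeList⁻ : ∀ {u v} {e : Edge n} → e ∈ edgeList u v → proj₁ e ≡ u × proj₁ (proj₂ e) ≡ v
∈-edgeList⁻ {u = u} {v} e∈ with u Fin.<? v | e∈
... | yes p | here refl = refl , refl

∈-edgeList⁺ : (e : Edge n) → e ∈ edgeList (proj₁ e) (proj₁ (proj₂ e))
∈-edgeList⁺ (u , v , p) with u Fin.<? v
... | yes _  = here (Edge-≡ refl refl)
... | no u≮v = contradiction p u≮v

edges-complete : (e : Edge n) → e ∈ edges n
edges-complete e@(u , v , _) = ∈-concatMap⁺ _ (lose (∈-allFin u)
  (∈-concatMap⁺ _ (lose (∈-allFin v) (∈-edgeList⁺ e))))

edges-Unique : ∀ n → Unique (edges n)
edges-Unique n = Unique-concatMap proj₁ (Unique.allFin⁺ n)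
  (λ u → Unique-concatMap (proj₁ ∘ proj₂) (Unique.allFin⁺ n) (Unique-edgeList u)
    λ {v} _ → proj₂ ∘ ∈-edgeList⁻ {u = u} {v})
  λ {u} _ e∈ → case find (∈-concatMap⁻ (edgeList u) {xs = allFin n} e∈) of λ (v , _ , e∈uv) →
    proj₁ (∈-edgeList⁻ {u = u} {v} e∈uv)
  where
  Unique-edgeList : ∀ (u v : Fin n) → Unique (edgeList u v)
  Unique-edgeList u v with u Fin.<? v
  ... | yes _ = [] ∷ []
  ... | no  _ = []

module _ (G : Graph n) where

  edgesOf-Unique : Unique (edgesOf G)
  edgesOf-Unique = Unique.filter⁺ _ (edges-Unique n)

  ∈-edgesOf⁺ : ∀ {e} → G e ≡ true → e ∈ edgesOf G
  ∈-edgesOf⁺ {e} = ∈-filter⁺ (λ x → G x Bool.≟ true) (edges-complete e)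

  ∈-edgesOf⁻ : ∀ {e} → e ∈ edgesOf G → G e ≡ true
  ∈-edgesOf⁻ = proj₂ ∘ ∈-filter⁻ (λ x → G x Bool.≟ true) {xs = edges n}

select-true : (xs : List A) → select (λ _ → true) xs ≡ xs
select-true []       = refl
select-true (x ∷ xs) = cong (x ∷_) (select-true xs)

sum-const : ∀ n c → sum {n} (λ _ → c) ≡ n * c
sum-const zero    c = refl
sum-const (suc n) c = cong (_+_ c) (sum-const n c)

-- The comparison of u + 1 with v + 1 computes to that of u with v, so K_{n+1} unfolds to
-- the star at 0 and a copy of K_n.
length-edges : ∀ n → length (edges n) ≡ n C 2
length-edges n = trans (cong length (sym (select-true (edges n))))
  (trans (length-select-concatMap (λ _ → true) (λ u → concatMap (edgeList u) (allFin n)) {n} id)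
    (trans (sum-cong-≗ row) (go n)))
  where
  row : ∀ u → length (select (λ _ → true) (concatMap (edgeList u) (allFin n))) ≡ count (λ (v : Fin n) → does (u Fin.<? v))
  row u = trans (length-select-concatMap (λ _ → true) (edgeList u) {n} id)
    (trans (sum-cong-≗ cell) (sym (count≡sum (λ (v : Fin n) → does (u Fin.<? v)))))
    where
    cell : ∀ v → length (select (λ _ → true) (edgeList u v)) ≡ indicator (does (u Fin.<? v))
    cell v = trans cell′ (cong indicator (isYes≗does (u Fin.<? v)))
      where
      cell′ : length (select (λ _ → true) (edgeList u v)) ≡ indicator ⌊ u Fin.<? v ⌋
      cell′ with u Fin.<? v
      ... | yes _ = refl
      ... | no  _ = refl

  go : ∀ n → sum (λ (u : Fin n) → count (λ (v : Fin n) → does (u Fin.<? v))) ≡ n C 2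
  go zero    = refl
  go (suc n) = trans (cong₂ _+_ star (go n)) (trans (cong (_+ n C 2) (sym (nC1≡n n))) (nCk+nC[k+1]≡[n+1]C[k+1] n 1))
    where
    star : count (λ (v : Fin n) → true) ≡ n
    star = trans (count≡sum {n} (λ _ → true)) (trans (sum-const n 1) (ℕ.*-identityʳ n))

-- Fractions, shapes and maximum average degree

fraction-≃ : ∀ a b → ℚ.toℚᵘ (+ a / suc b) ℚᵘ.≃ mkℚᵘ (+ a) b
fraction-≃ a b = ℚ.toℚᵘ-fromℚᵘ (mkℚᵘ (+ a) b)

fraction-≤ : ∀ a b c d → a * suc d ≤ c * suc b → + a / suc b ℚ.≤ + c / suc d
fraction-≤ a b c d ad≤cb = ℚ.toℚᵘ-cancel-≤
  (ℚᵘ.≤-respˡ-≃ (ℚᵘ.≃-sym (fraction-≃ a b)) (ℚᵘ.≤-respʳ-≃ (ℚᵘ.≃-sym (fraction-≃ c d))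
    (*≤* (subst₂ ℤ._≤_ (ℤ.pos-* a (suc d)) (ℤ.pos-* c (suc b)) (+≤+ ad≤cb)))))

fraction-≤⁻ : ∀ a b c d → + a / suc b ℚ.≤ + c / suc d → a * suc d ≤ c * suc b
fraction-≤⁻ a b c d le
  with *≤* p ← ℚᵘ.≤-respˡ-≃ (fraction-≃ a b) (ℚᵘ.≤-respʳ-≃ (fraction-≃ c d) (ℚ.toℚᵘ-mono-≤ le))
  = ℤ.drop‿+≤+ (subst₂ ℤ._≤_ (sym (ℤ.pos-* a (suc d))) (sym (ℤ.pos-* c (suc b))) p)

fraction-≡ : ∀ a b c d → a * suc d ≡ c * suc b → + a / suc b ≡ + c / suc d
fraction-≡ a b c d eq = ℚ.≤-antisym (fraction-≤ a b c d (ℕ.≤-reflexive eq)) (fraction-≤ c d a b (ℕ.≤-reflexive (sym eq)))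

-- A sixth is a common unit for 1, 2 and 4/3, the Mads of K₂, K₃ and P₃, and for the bound E/2, so
-- that sums of Mads can be compared as natural numbers.
sixth : ℕ → ℚ
sixth a = + a / 6

sixth-mono : ∀ {a b} → a ≤ b → sixth a ℚ.≤ sixth b
sixth-mono {a} {b} a≤b = fraction-≤ a 5 b 5 (ℕ.*-monoˡ-≤ 6 a≤b)

sixth-+ : ∀ a b → sixth a ℚ.+ sixth b ≡ sixth (a + b)
sixth-+ a b = ℚ.toℚᵘ-injective (begin
  ℚ.toℚᵘ (sixth a ℚ.+ sixth b)            ≈⟨ ℚ.toℚᵘ-homo-+ (sixth a) (sixth b) ⟩
  ℚ.toℚᵘ (sixth a) ℚᵘ.+ ℚ.toℚᵘ (sixth b)  ≈⟨ ℚᵘ.+-cong (fraction-≃ a 5) (fraction-≃ b 5) ⟩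
  mkℚᵘ (+ a) 5 ℚᵘ.+ mkℚᵘ (+ b) 5          ≈⟨ *≡* lemma ⟩
  mkℚᵘ (+ (a + b)) 5                      ≈⟨ fraction-≃ (a + b) 5 ⟨
  ℚ.toℚᵘ (sixth (a + b))                  ∎)
  where
  open import Relation.Binary.Reasoning.Setoid ℚᵘ.≃-setoid
  lemma : (+ a ℤ.* + 6 ℤ.+ + b ℤ.* + 6) ℤ.* + 6 ≡ + (a + b) ℤ.* + 36
  lemma = trans (cong (ℤ._* + 6) (trans (sym (ℤ.*-distribʳ-+ (+ 6) (+ a) (+ b)))
                                         (cong (ℤ._* + 6) (sym (ℤ.pos-+ a b)))))
                (ℤ.*-assoc (+ (a + b)) (+ 6) (+ 6))

ratio-≤ : ∀ e v u → 2 * e * 6 ≤ u * v → ratio e v ℚ.≤ sixth u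
ratio-≤ e zero    u _  = fraction-≤ 0 0 u 5 z≤n
ratio-≤ e (suc v) u le = fraction-≤ (2 * e) v u 5 le

Joins : Edge n → Fin n → Fin n → Set
Joins (u , v , _) = SameEdge u v

Joins-sym : ∀ (e : Edge n) {a b} → Joins e a b → Joins e b a
Joins-sym _ (inj₁ (p , q)) = inj₂ (p , q)
Joins-sym _ (inj₂ (p , q)) = inj₁ (p , q)

Joins-unique : ∀ {e f : Edge n} {a b} → Joins e a b → Joins f a b → e ≡ f
Joins-unique (inj₁ (refl , refl)) (inj₁ (refl , refl)) = Edge-≡ refl refl
Joins-unique (inj₂ (refl , refl)) (inj₂ (refl , refl)) = Edge-≡ refl refl
Joins-unique {e = _ , _ , p} {_ , _ , q} (inj₁ (refl , refl)) (inj₂ (refl , refl)) =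
  contradiction q (ℕ.<-asym p)
Joins-unique {e = _ , _ , p} {_ , _ , q} (inj₂ (refl , refl)) (inj₁ (refl , refl)) =
  contradiction q (ℕ.<-asym p)

Joins-≢ : ∀ (e : Edge n) {a b} → Joins e a b → a ≢ b
Joins-≢ (_ , _ , p) (inj₁ (refl , refl)) refl = ℕ.<-irrefl refl p
Joins-≢ (_ , _ , p) (inj₂ (refl , refl)) refl = ℕ.<-irrefl refl p

edge : (a b : Fin n) → a ≢ b → Edge n
edge a b a≢b with Fin.<-cmp a b
... | tri< a<b _ _ = a , b , a<b
... | tri≈ _ a≡b _ = contradiction a≡b a≢b
... | tri> _ _ b<a = b , a , b<a

edge-joins : ∀ (a b : Fin n) (a≢b : a ≢ b) → Joins (edge a b a≢b) a b
edge-joins a b a≢b with Fin.<-cmp a b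
... | tri< _ _ _   = inj₁ (refl , refl)
... | tri≈ _ a≡b _ = contradiction a≡b a≢b
... | tri> _ _ _   = inj₂ (refl , refl)

-- `weight` is six times the Mad of the shape; `deficit` is what it lacks of 3 · `size` + 3, which
-- is (E + 1)/2 in sixths.
size weight deficit : Shape → ℕ
size k2 = 1
size k3 = 3
size p3 = 2
weight k2 = 6
weight k3 = 12
weight p3 = 8
deficit σ = indicator (isP3 σ)

data IsShape {n} : List (Edge n) → Shape → Set where
  k2 : ∀ e → IsShape (e ∷ []) k2
  k3 : ∀ {e f g a b c} → Joins e a b → Joins f b c → Joins g a c → IsShape (e ∷ f ∷ g ∷ []) k3
  p3 : ∀ {e f a b c} → Joins e a b → Joins f b c → a ≢ c → IsShape (e ∷ f ∷ []) p3

record EdgeSet (G : Graph n) (es : List (Edge n)) : Set where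
  constructor edgeSet
  field
    sound    : ∀ {e} → e ∈ es → G e ≡ true
    complete : ∀ {e} → G e ≡ true → e ∈ es

  countEdges≡ : Unique es → countEdges G ≡ length es
  countEdges≡ es! = trans (countEdges≡length G) (ℕ.≤-antisym
    (length-Unique-⊆ (edgesOf-Unique G) (complete ∘ ∈-edgesOf⁻ G))
    (length-Unique-⊆ es! (∈-edgesOf⁺ G ∘ sound)))

open EdgeSet

hasShape : ∀ {G : Graph n} {es σ} → EdgeSet G es → IsShape es σ → HasShape G σ
hasShape {G = G} G≈ (k2 (a , b , a<b)) = a , b , (λ { refl → ℕ.<-irrefl refl a<b }) , λ u v p →
  (λ Ge → case complete G≈ Ge of λ { (here refl) → inj₁ (refl , refl) }) ,
  (λ j → sound G≈ (here (Joins-unique {e = u , v , p} {a , b , a<b} j (inj₁ (refl , refl)))))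
hasShape {G = G} G≈ (k3 {e} {f} {g} {a} {b} {c} ab bc ac) =
  a , b , c , Joins-≢ e ab , Joins-≢ f bc , Joins-≢ g ac , λ u v p →
  (λ Ge → case complete G≈ Ge of λ
    { (here refl) → inj₁ ab ; (there (here refl)) → inj₂ (inj₁ bc)
    ; (there (there (here refl))) → inj₂ (inj₂ ac) }) ,
  λ { (inj₁ j) → sound G≈ (here (Joins-unique {e = u , v , p} {e} j ab))
    ; (inj₂ (inj₁ j)) → sound G≈ (there (here (Joins-unique {e = u , v , p} {f} j bc)))
    ; (inj₂ (inj₂ j)) → sound G≈ (there (there (here (Joins-unique {e = u , v , p} {g} j ac)))) }
hasShape {G = G} G≈ (p3 {e} {f} {a} {b} {c} ab bc a≢c) =
  a , b , c , Joins-≢ e ab , Joins-≢ f bc , a≢c , λ u v p →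
  (λ Ge → case complete G≈ Ge of λ { (here refl) → inj₁ ab ; (there (here refl)) → inj₂ bc }) ,
  λ { (inj₁ j) → sound G≈ (here (Joins-unique {e = u , v , p} {e} j ab))
    ; (inj₂ j) → sound G≈ (there (here (Joins-unique {e = u , v , p} {f} j bc))) }

-- What v vertices can carry: one edge on two, part of a triangle on three. From four vertices on no
-- limit is recorded, because 2e/v ≤ e/2 is then small enough.
data Support {n} : List (Edge n) → ℕ → Set where
  none   : ∀ {v} → Support [] v
  pair   : ∀ {es} → length es ≤ 1 → Support es 2
  triple : ∀ {es e f g a b c} → Joins e a b → Joins f b c → Joins g a c → es ⊆ e ∷ f ∷ g ∷ [] → Support es 3
  large  : ∀ {es v} → 4 ≤ v → Support es v

support : ∀ {es : List (Edge n)} {vs} → Unique es → Unique vs →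
  (∀ {e} → e ∈ es → proj₁ e ∈ vs × proj₁ (proj₂ e) ∈ vs) → Support es (length vs)
support {es = []} _ _ _ = none
support {es = e ∷ _} {[]} es! vs! ends with () ← proj₁ (ends {e} (here refl))
support {es = e ∷ _} {a ∷ []} es! vs! ends with e | ends {e} (here refl)
... | _ , _ , p | here refl , here refl = contradiction p (ℕ.<-irrefl refl)
support {es = es} {a ∷ b ∷ []} es! ((a≢b ∷ []) ∷ _) ends = pair (length-Unique-⊆ es! on)
  where
  ab = edge-joins a b a≢b
  on : es ⊆ edge a b a≢b ∷ []
  on {e@(_ , _ , p)} e∈ with ends e∈
  ... | here refl , here refl = contradiction p (ℕ.<-irrefl refl)
  ... | here refl , there (here refl) = here (Joins-unique (inj₁ (refl , refl)) ab)
  ... | there (here refl) , here refl = here (Joins-unique (inj₂ (refl , refl)) ab)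
  ... | there (here refl) , there (here refl) = contradiction p (ℕ.<-irrefl refl)
support {es = es} {a ∷ b ∷ c ∷ []} es! ((a≢b ∷ a≢c ∷ []) ∷ (b≢c ∷ []) ∷ _) ends = triple ab bc ac on
  where
  ab = edge-joins a b a≢b
  bc = edge-joins b c b≢c
  ac = edge-joins a c a≢c
  on : es ⊆ edge a b a≢b ∷ edge b c b≢c ∷ edge a c a≢c ∷ []
  on {e@(_ , _ , p)} e∈ with ends e∈
  ... | here refl , here refl = contradiction p (ℕ.<-irrefl refl)
  ... | here refl , there (here refl) = here (Joins-unique (inj₁ (refl , refl)) ab)
  ... | here refl , there (there (here refl)) = there (there (here (Joins-unique (inj₁ (refl , refl)) ac)))
  ... | there (here refl) , here refl = here (Joins-unique (inj₂ (refl , refl)) ab)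
  ... | there (here refl) , there (here refl) = contradiction p (ℕ.<-irrefl refl)
  ... | there (here refl) , there (there (here refl)) = there (here (Joins-unique (inj₁ (refl , refl)) bc))
  ... | there (there (here refl)) , here refl = there (there (here (Joins-unique (inj₂ (refl , refl)) ac)))
  ... | there (there (here refl)) , there (here refl) = there (here (Joins-unique (inj₂ (refl , refl)) bc))
  ... | there (there (here refl)) , there (there (here refl)) = contradiction p (ℕ.<-irrefl refl)
support {vs = _ ∷ _ ∷ _ ∷ _ ∷ _} _ _ _ = large (s≤s (s≤s (s≤s (s≤s z≤n))))

module _ {G : Graph n} (H : Subgraph G) where
  open Subgraph H

  order : ℕ
  order = length (select S (allFin n))

  density≡ : density H ≡ ratio (length (edgesOf F)) order
  density≡ = cong₂ ratio (countEdges≡length F) (count≡length S)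

  subgraph-⊆ : edgesOf F ⊆ edgesOf G
  subgraph-⊆ {u , v , p} e∈ = ∈-edgesOf⁺ G (proj₁ (F⊆G u v p (∈-edgesOf⁻ F e∈)))

  subgraph-support : Support (edgesOf F) order
  subgraph-support = support (edgesOf-Unique F) (Unique.filter⁺ _ (Unique.allFin⁺ n)) λ {(u , v , p)} e∈ →
    let (_ , Su , Sv) = F⊆G u v p (∈-edgesOf⁻ F e∈) in
    ∈-filter⁺ (λ x → S x Bool.≟ true) (∈-allFin u) Su , ∈-filter⁺ (λ x → S x Bool.≟ true) (∈-allFin v) Sv

-- The worst case has the most edges, the fewest vertices and the smallest bound. Checking it alone
-- turns nearly every case below into an inequality of numerals.
scale : ∀ {e v u} e′ v′ u′ → e ≤ e′ → v′ ≤ v → u′ ≤ u → 2 * e′ * 6 ≤ u′ * v′ → 2 * e * 6 ≤ u * v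
scale e′ v′ u′ e≤ v≤ u≤ le = ℕ.≤-trans (ℕ.*-monoˡ-≤ 6 (ℕ.*-monoʳ-≤ 2 e≤)) (ℕ.≤-trans le (ℕ.*-mono-≤ u≤ v≤))

support-≤ : ∀ {es : List (Edge n)} {v} σ → length es ≤ size σ → Support es v → 2 * length es * 6 ≤ weight σ * v
support-≤ {es = es} {v} σ e≤ sup = go σ e≤ sup
  where
  by : ∀ σ e′ v′ → length es ≤ e′ → v′ ≤ v → 2 * e′ * 6 ≤ weight σ * v′ → 2 * length es * 6 ≤ weight σ * v
  by σ e′ v′ e≤ v≤ = scale e′ v′ (weight σ) e≤ v≤ ℕ.≤-refl

  go : ∀ σ → length es ≤ size σ → Support es v → 2 * length es * 6 ≤ weight σ * v
  go σ  _  none             = z≤n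
  go k2 _  (pair e≤1)       = by k2 1 2 e≤1 ℕ.≤-refl (from-yes (12 ≤? 12))
  go k3 _  (pair e≤1)       = by k3 1 2 e≤1 ℕ.≤-refl (from-yes (12 ≤? 24))
  go p3 _  (pair e≤1)       = by p3 1 2 e≤1 ℕ.≤-refl (from-yes (12 ≤? 16))
  go k2 e≤ (triple _ _ _ _) = by k2 1 3 e≤ ℕ.≤-refl (from-yes (12 ≤? 18))
  go k3 e≤ (triple _ _ _ _) = by k3 3 3 e≤ ℕ.≤-refl (from-yes (36 ≤? 36))
  go p3 e≤ (triple _ _ _ _) = by p3 2 3 e≤ ℕ.≤-refl (from-yes (24 ≤? 24))
  go k2 e≤ (large 4≤v)      = by k2 1 4 e≤ 4≤v (from-yes (12 ≤? 24))
  go k3 e≤ (large 4≤v)      = by k3 3 4 e≤ 4≤v (from-yes (36 ≤? 48))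
  go p3 e≤ (large 4≤v)      = by p3 2 4 e≤ 4≤v (from-yes (24 ≤? 32))

density-≤ : ∀ {G : Graph n} (H : Subgraph G) u →
  2 * length (edgesOf (Subgraph.F H)) * 6 ≤ u * order H → density H ℚ.≤ sixth u
density-≤ H u le = subst (ℚ._≤ sixth u) (sym (density≡ H)) (ratio-≤ _ (order H) u le)

_∈ᵇ_ : Fin n → List (Fin n) → Bool
x ∈ᵇ xs = ⌊ Any.any? (x Fin.≟_) xs ⌋

∈ᵇ⁺ : ∀ {x : Fin n} {xs} → x ∈ xs → (x ∈ᵇ xs) ≡ true
∈ᵇ⁺ {x = x} {xs} x∈ with Any.any? (x Fin.≟_) xs
... | yes _  = refl
... | no x∉  = contradiction x∈ x∉

∈ᵇ⁻ : ∀ {x : Fin n} {xs} → (x ∈ᵇ xs) ≡ true → x ∈ xs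
∈ᵇ⁻ {x = x} {xs} eq with Any.any? (x Fin.≟_) xs
... | yes x∈ = x∈

count-∈ᵇ : ∀ {xs : List (Fin n)} → Unique xs → count (_∈ᵇ xs) ≡ length xs
count-∈ᵇ {n} {xs} xs! = trans (count≡length (_∈ᵇ xs)) (ℕ.≤-antisym
  (length-Unique-⊆ (Unique.filter⁺ P? (Unique.allFin⁺ n)) (∈ᵇ⁻ ∘ proj₂ ∘ ∈-filter⁻ P? {xs = allFin n}))
  (length-Unique-⊆ xs! λ {x} x∈ → ∈-filter⁺ P? (∈-allFin x) (∈ᵇ⁺ x∈)))
  where P? = λ x → (x ∈ᵇ xs) Bool.≟ true

Joins-ends : ∀ {vs x y} (e : Edge n) → Joins e x y → x ∈ vs → y ∈ vs → proj₁ e ∈ vs × proj₁ (proj₂ e) ∈ vs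
Joins-ends e (inj₁ (refl , refl)) x∈ y∈ = x∈ , y∈
Joins-ends e (inj₂ (refl , refl)) x∈ y∈ = y∈ , x∈

length≡size : ∀ {es : List (Edge n)} {σ} → IsShape es σ → length es ≡ size σ
length≡size (k2 _)     = refl
length≡size (k3 _ _ _) = refl
length≡size (p3 _ _ _) = refl

record Spanning (es : List (Edge n)) (m : ℚ) : Set where
  field
    vertices : List (Fin n)
    distinct : Unique vertices
    contains : ∀ {e} → e ∈ es → proj₁ e ∈ vertices × proj₁ (proj₂ e) ∈ vertices
    average  : ratio (length es) (length vertices) ≡ m
    vertex   : ∃ λ x → x ∈ vertices

spanning : ∀ {es : List (Edge n)} {σ} → IsShape es σ → Spanning es (sixth (weight σ))
spanning (k2 (a , b , p)) = record
  { vertices = a ∷ b ∷ []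
  ; distinct = ((λ { refl → ℕ.<-irrefl refl p }) ∷ []) ∷ [] ∷ []
  ; contains = λ { (here refl) → here refl , there (here refl) }
  ; average  = refl
  ; vertex   = a , here refl }
spanning (k3 {e} {f} {g} {a} {b} {c} ab bc ac) = record
  { vertices = a ∷ b ∷ c ∷ []
  ; distinct = (Joins-≢ e ab ∷ Joins-≢ g ac ∷ []) ∷ (Joins-≢ f bc ∷ []) ∷ [] ∷ []
  ; contains = λ
      { (here refl)                 → Joins-ends e ab (here refl) (there (here refl))
      ; (there (here refl))         → Joins-ends f bc (there (here refl)) (there (there (here refl)))
      ; (there (there (here refl))) → Joins-ends g ac (here refl) (there (there (here refl))) }
  ; average  = refl
  ; vertex   = a , here refl }
spanning (p3 {e} {f} {a} {b} {c} ab bc a≢c) = record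
  { vertices = a ∷ b ∷ c ∷ []
  ; distinct = (Joins-≢ e ab ∷ a≢c ∷ []) ∷ (Joins-≢ f bc ∷ []) ∷ [] ∷ []
  ; contains = λ
      { (here refl)         → Joins-ends e ab (here refl) (there (here refl))
      ; (there (here refl)) → Joins-ends f bc (there (here refl)) (there (there (here refl))) }
  ; average  = refl
  ; vertex   = a , here refl }

-- The graph without its isolated vertices attains the value. For every other subgraph, more
-- vertices lower the density and fewer cannot carry the edges.
shape-IsMad : ∀ {G : Graph n} {es σ} → EdgeSet G es → Unique es → IsShape es σ → IsMad G (sixth (weight σ))
shape-IsMad {n} {G} {es} {σ} G≈ es! sh =
  (whole , trans (cong₂ ratio (countEdges≡ G≈ es!) (count-∈ᵇ distinct)) average) ,
  λ H → density-≤ H (weight σ) (support-≤ σ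
    (ℕ.≤-trans (length-Unique-⊆ (edgesOf-Unique (Subgraph.F H)) (subgraph-⊆ H)) (ℕ.≤-reflexive edges≡size))
    (subgraph-support H))
  where
  open Spanning (spanning sh)

  edges≡size : length (edgesOf G) ≡ size σ
  edges≡size = trans (sym (countEdges≡length G)) (trans (countEdges≡ G≈ es!) (length≡size sh))

  whole : Subgraph G
  whole = record
    { S        = _∈ᵇ vertices
    ; F        = G
    ; nonempty = proj₁ vertex , ∈ᵇ⁺ (proj₂ vertex)
    ; F⊆G      = λ u v p Ge → let (u∈ , v∈) = contains (complete G≈ Ge) in Ge , ∈ᵇ⁺ u∈ , ∈ᵇ⁺ v∈ }

-- `other` stands for a Mad of at most E/2, which is three sixths below (E + 1)/2; whatever comes
-- closer is one of the three shapes.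
data Verdict (G : Graph n) (m : ℚ) : Set where
  shaped : ∀ σ → HasShape G σ → countEdges G ≡ size σ → m ℚ.≤ sixth (weight σ) → Verdict G m
  other  : m ℚ.≤ sixth (3 * countEdges G) → Verdict G m

edgesOf-EdgeSet : (G : Graph n) → EdgeSet G (edgesOf G)
edgesOf-EdgeSet G = edgeSet (∈-edgesOf⁻ G) (∈-edgesOf⁺ G)

two-in-triangle : ∀ {x y e f g : Edge n} {a b c} → Joins e a b → Joins f b c → Joins g a c → x ≢ y →
  x ∈ e ∷ f ∷ g ∷ [] → y ∈ e ∷ f ∷ g ∷ [] → IsShape (x ∷ y ∷ []) p3
two-in-triangle {e = e} {f} {g} ab bc ac x≢y = λ
  { (here refl)                 (here refl)                 → contradiction refl x≢y
  ; (here refl)                 (there (here refl))         → p3 ab bc (Joins-≢ g ac)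
  ; (here refl)                 (there (there (here refl))) → p3 (Joins-sym e ab) ac (Joins-≢ f bc)
  ; (there (here refl))         (here refl)                 → p3 (Joins-sym f bc) (Joins-sym e ab) (Joins-≢ g ac ∘ sym)
  ; (there (here refl))         (there (here refl))         → contradiction refl x≢y
  ; (there (here refl))         (there (there (here refl))) → p3 bc (Joins-sym g ac) (Joins-≢ e ab ∘ sym)
  ; (there (there (here refl))) (here refl)                 → p3 (Joins-sym g ac) ab (Joins-≢ f bc ∘ sym)
  ; (there (there (here refl))) (there (here refl))         → p3 ac (Joins-sym f bc) (Joins-≢ e ab)
  ; (there (there (here refl))) (there (there (here refl))) → contradiction refl x≢y }

module _ {G : Graph n} (H : Subgraph G) where
  private
    fs = edgesOf (Subgraph.F H)
    gs = edgesOf G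
    fs! = edgesOf-Unique (Subgraph.F H)
    gs! = edgesOf-Unique G
    E≡ = countEdges≡length G

    fs≤gs : length fs ≤ length gs
    fs≤gs = length-Unique-⊆ fs! (subgraph-⊆ H)

    sparse : ∀ e v g → length fs ≤ e → v ≤ order H → g ≤ length gs → 2 * e * 6 ≤ 3 * g * v → Verdict G (density H)
    sparse e v g e≤ v≤ ≤g le = other (subst (λ E → density H ℚ.≤ sixth (3 * E)) (sym E≡)
      (density-≤ H (3 * length gs) (scale e v (3 * g) e≤ v≤ (ℕ.*-monoʳ-≤ 3 ≤g) le)))

    isShaped : ∀ {es} σ → EdgeSet G es → IsShape es σ → length gs ≡ size σ → Verdict G (density H)
    isShaped σ G≈ sh len = shaped σ (hasShape G≈ sh) (trans E≡ len) (density-≤ H (weight σ)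
      (support-≤ σ (ℕ.≤-trans fs≤gs (ℕ.≤-reflexive len)) (subgraph-support H)))

    single : ∀ {x} → gs ≡ x ∷ [] → Verdict G (density H)
    single {x} gs≡ = isShaped k2 (subst (EdgeSet G) gs≡ (edgesOf-EdgeSet G)) (k2 x) (cong length gs≡)

    empty : gs ≡ [] → Verdict G (density H)
    empty gs≡ = sparse 0 0 0 (subst (length fs ≤_) (cong length gs≡) fs≤gs) z≤n z≤n z≤n

  -- With E edges in G, a density above E/2 needs at most three vertices, and then leaves no room
  -- for edges of G outside the subgraph.
  density-verdict : Verdict G (density H)
  density-verdict = go fs refl gs refl refl (subgraph-support H)
    where
    go : ∀ fs′ → fs ≡ fs′ → ∀ gs′ → gs ≡ gs′ → ∀ {v} → order H ≡ v → Support fs′ v → Verdict G (density H)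
    go _ fs≡ _ gs≡ v≡ none = sparse 0 0 0 (ℕ.≤-reflexive (cong length fs≡)) z≤n z≤n z≤n
    go _ fs≡ _ gs≡ v≡ (large 4≤v) = sparse (length gs) 4 (length gs) fs≤gs (subst (4 ≤_) (sym v≡) 4≤v) ℕ.≤-refl
      (ℕ.≤-reflexive (solve 1 (λ g → con 2 :* g :* con 6 := con 3 :* g :* con 4) refl (length gs)))
    go _ fs≡ [] gs≡ v≡ (pair _) = empty gs≡
    go _ fs≡ (_ ∷ []) gs≡ v≡ (pair _) = single gs≡
    go _ refl (_ ∷ _ ∷ _) gs≡ v≡ (pair e≤1) = sparse 1 2 2 e≤1 (ℕ.≤-reflexive (sym v≡))
      (subst (2 ≤_) (sym (cong length gs≡)) (s≤s (s≤s z≤n))) (from-yes (12 ≤? 12))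
    go _ fs≡ [] gs≡ v≡ (triple _ _ _ _) = empty gs≡
    go _ fs≡ (_ ∷ []) gs≡ v≡ (triple _ _ _ _) = single gs≡
    go _ refl (x ∷ y ∷ []) gs≡ v≡ (triple ab bc ac fs⊆) with length fs ≤? 1
    ... | yes e≤1 = sparse 1 3 2 e≤1 (ℕ.≤-reflexive (sym v≡)) (ℕ.≤-reflexive (sym (cong length gs≡))) (from-yes (12 ≤? 18))
    ... | no  e≰1 = isShaped p3 (subst (EdgeSet G) gs≡ (edgesOf-EdgeSet G))
        (two-in-triangle ab bc ac x≢y (fs⊆ (gs⊆fs (here refl))) (fs⊆ (gs⊆fs (there (here refl))))) (cong length gs≡)
      where
      gs⊆fs : x ∷ y ∷ [] ⊆ fs
      gs⊆fs = ≤-length⇒⊇ _≟ᴱ_ fs! (subst (fs ⊆_) gs≡ (subgraph-⊆ H)) (ℕ.≰⇒> e≰1)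
      x≢y : x ≢ y
      x≢y with (x≢y ∷ []) ∷ _ ← subst Unique gs≡ gs! = x≢y
    go _ refl (_ ∷ _ ∷ _ ∷ []) gs≡ v≡ (triple {e = e} {f} {g} ab bc ac fs⊆) with length fs ≤? 2
    ... | yes e≤2 = sparse 2 3 3 e≤2 (ℕ.≤-reflexive (sym v≡)) (ℕ.≤-reflexive (sym (cong length gs≡))) (from-yes (24 ≤? 27))
    ... | no  e≰2 = isShaped k3 (edgeSet (∈-edgesOf⁻ G ∘ efg⊆gs) (gs⊆efg ∘ ∈-edgesOf⁺ G)) (k3 ab bc ac) (cong length gs≡)
      where
      gs⊆efg : gs ⊆ e ∷ f ∷ g ∷ []
      gs⊆efg = fs⊆ ∘ ≤-length⇒⊇ _≟ᴱ_ fs! (subgraph-⊆ H) (subst (_≤ length fs) (sym (cong length gs≡)) (ℕ.≰⇒> e≰2))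
      efg⊆gs : e ∷ f ∷ g ∷ [] ⊆ gs
      efg⊆gs = ≤-length⇒⊇ _≟ᴱ_ gs! gs⊆efg (ℕ.≤-reflexive (sym (cong length gs≡)))
    go _ refl (_ ∷ _ ∷ _ ∷ _ ∷ _) gs≡ v≡ (triple _ _ _ fs⊆) = sparse 3 3 4 (length-Unique-⊆ fs! fs⊆) (ℕ.≤-reflexive (sym v≡))
      (subst (4 ≤_) (sym (cong length gs≡)) (s≤s (s≤s (s≤s (s≤s z≤n))))) (from-yes (36 ≤? 36))

verdict : ∀ {G : Graph n} {m} → IsMad G m → Verdict G m
verdict {G = G} ((H , refl) , _) = density-verdict H

-- The upper bound

sum-indicator-≟ : (j : Fin k) → sum (λ i → indicator ⌊ j Fin.≟ i ⌋) ≡ 1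
sum-indicator-≟ {suc k} zero    = cong suc (trans (sum-const k 0) (ℕ.*-zeroʳ k))
sum-indicator-≟ {suc k} (suc j) = trans (sum-cong-≗ step) (sum-indicator-≟ j)
  where
  step : ∀ i → indicator ⌊ Fin.suc j Fin.≟ suc i ⌋ ≡ indicator ⌊ j Fin.≟ i ⌋
  step i with j Fin.≟ i
  ... | yes _ = refl
  ... | no  _ = refl

-- By induction on the list of all edges: each edge adds 1 in the part of its own colour and 0
-- elsewhere.
sum-parts : (c : Edge n → Fin k) → sum (λ i → countEdges (part c i)) ≡ n C 2
sum-parts {n} {k} c = trans (sum-cong-≗ (λ i → countEdges≡length (part c i))) (trans (go (edges n)) (length-edges n))
  where
  go : ∀ es → sum (λ i → length (select (part c i) es)) ≡ length es
  go []       = trans (sum-const k 0) (ℕ.*-zeroʳ k)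
  go (e ∷ es) = trans (sum-cong-≗ (λ i → length-select-∷ (part c i) e es))
    (trans (∑-distrib-+ (λ i → indicator (part c i e)) (λ i → length (select (part c i) es)))
           (cong₂ _+_ (sum-indicator-≟ (c e)) (go es)))

sum-* : ∀ a (f : Fin k → ℕ) → sum (λ i → a * f i) ≡ a * sum f
sum-* {zero}  a f = sym (ℕ.*-zeroʳ a)
sum-* {suc k} a f = trans (cong (_+_ (a * f zero)) (sum-* a (f ∘ suc))) (sym (ℕ.*-distribˡ-+ a (f zero) _))

≤-sum : ∀ (f : Fin k → ℕ) i → f i ≤ sum f
≤-sum f zero    = ℕ.m≤m+n (f zero) _
≤-sum f (suc i) = ℕ.≤-trans (≤-sum (f ∘ suc) i) (ℕ.m≤n+m _ (f zero))

sumℚ-≤ : ∀ {m : Fin k → ℚ} {u} → (∀ i → m i ℚ.≤ sixth (u i)) → sumℚ m ℚ.≤ sixth (sum u)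
sumℚ-≤ {zero}  _  = fraction-≤ 0 0 0 5 z≤n
sumℚ-≤ {suc k} {u = u} m≤ = subst (_ ℚ.≤_) (sixth-+ (u zero) _) (ℚ.+-mono-≤ (m≤ zero) (sumℚ-≤ (m≤ ∘ suc)))

module _ {G : Graph n} {m : ℚ} where

  bound loss : Verdict G m → ℕ
  bound (shaped σ _ _ _) = weight σ
  bound (other _)        = 3 * countEdges G
  loss  (shaped σ _ _ _) = deficit σ
  loss  (other _)        = 3

  ≤-bound : ∀ V → m ℚ.≤ sixth (bound V)
  ≤-bound (shaped _ _ _ le) = le
  ≤-bound (other le)        = le

  bound+loss : ∀ V → bound V + loss V ≡ 3 * countEdges G + 3
  bound+loss (shaped k2 _ E≡ _) = cong (λ E → 3 * E + 3) (sym E≡)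
  bound+loss (shaped k3 _ E≡ _) = cong (λ E → 3 * E + 3) (sym E≡)
  bound+loss (shaped p3 _ E≡ _) = cong (λ E → 3 * E + 3) (sym E≡)
  bound+loss (other _)          = refl

  small-loss : ∀ V → loss V ≤ 1 → Σ Shape λ σ → HasShape G σ × countEdges G ≡ size σ × loss V ≡ deficit σ
  small-loss (shaped σ sh E≡ _) _ = σ , sh , E≡ , refl
  small-loss (other _) (s≤s ())

count-shapes : (σ : Fin k → Shape) →
  count (isK3 ∘ σ) + count (isK2 ∘ σ) + count (isP3 ∘ σ) ≡ k
count-shapes {zero}  σ = refl
count-shapes {suc k} σ with σ zero | count-shapes (σ ∘ suc)
... | k2 | eq = trans (cong (_+ count (isP3 ∘ σ ∘ suc)) (ℕ.+-suc _ _)) (cong suc eq)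
... | k3 | eq = cong suc eq
... | p3 | eq = trans (ℕ.+-suc _ _) (cong suc eq)

sum-sizes : (σ : Fin k → Shape) →
  3 * count (isK3 ∘ σ) + count (isK2 ∘ σ) + 2 * count (isP3 ∘ σ) ≡ sum (size ∘ σ)
sum-sizes {zero}  σ = refl
sum-sizes {suc k} σ with σ zero | sum-sizes (σ ∘ suc)
... | k2 | eq = trans (solve 3 (λ a b d → con 3 :* a :+ (con 1 :+ b) :+ con 2 :* d := con 1 :+ (con 3 :* a :+ b :+ con 2 :* d)) refl
    (count (isK3 ∘ σ ∘ suc)) (count (isK2 ∘ σ ∘ suc)) (count (isP3 ∘ σ ∘ suc))) (cong (_+_ 1) eq)
... | k3 | eq = trans (solve 3 (λ a b d → con 3 :* (con 1 :+ a) :+ b :+ con 2 :* d := con 3 :+ (con 3 :* a :+ b :+ con 2 :* d)) refl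
    (count (isK3 ∘ σ ∘ suc)) (count (isK2 ∘ σ ∘ suc)) (count (isP3 ∘ σ ∘ suc))) (cong (_+_ 3) eq)
... | p3 | eq = trans (solve 3 (λ a b d → con 3 :* a :+ b :+ con 2 :* (con 1 :+ d) := con 2 :+ (con 3 :* a :+ b :+ con 2 :* d)) refl
    (count (isK3 ∘ σ ∘ suc)) (count (isK2 ∘ σ ∘ suc)) (count (isP3 ∘ σ ∘ suc))) (cong (_+_ 2) eq)

-- The difference of `total` and `parts` is 2a + d, the number of edges minus the number of parts.
record Tally (c : Edge n → Fin k) (d : ℕ) : Set where
  field
    {a b}    : ℕ
    multiset : PartsMultiset c a b d
    parts    : a + b + d ≡ k
    total    : 3 * a + b + 2 * d ≡ n C 2

-- `d` is the total loss in sixths. If it is at most 1, so is the loss of each part, which excludes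
-- the loss 3 of a part without a shape; then `d` is the number of paths P₃.
record Analysis (c : Edge n → Fin k) (m : Fin k → ℚ) : Set where
  field
    {U d}  : ℕ
    sum≤   : sumℚ m ℚ.≤ sixth U
    U+d≡   : U + d ≡ 3 * (n C 2) + 3 * k
    tally  : d ≤ 1 → Tally c d

analyse : {c : Edge n → Fin k} {m : Fin k → ℚ} → MadSum c m → Analysis c m
analyse {n} {k} {c} {m} mads = record
  { sum≤  = sumℚ-≤ (≤-bound ∘ V)
  ; U+d≡  = begin
      sum (bound ∘ V) + sum (loss ∘ V)                 ≡⟨ ∑-distrib-+ (bound ∘ V) (loss ∘ V) ⟨
      sum (λ i → bound (V i) + loss (V i))             ≡⟨ sum-cong-≗ (bound+loss ∘ V) ⟩
      sum (λ i → 3 * countEdges (part c i) + 3)        ≡⟨ ∑-distrib-+ (λ i → 3 * countEdges (part c i)) (λ _ → 3) ⟩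
      sum (λ i → 3 * countEdges (part c i)) + sum {k} (λ _ → 3)
        ≡⟨ cong₂ _+_ (trans (sum-* 3 (countEdges ∘ part c)) (cong (3 *_) (sum-parts c))) (trans (sum-const k 3) (ℕ.*-comm k 3)) ⟩
      3 * (n C 2) + 3 * k                              ∎
  ; tally = λ d≤1 → tally′ (λ i → small-loss (V i) (ℕ.≤-trans (≤-sum (loss ∘ V) i) d≤1)) }
  where
  open ≡-Reasoning
  V : ∀ i → Verdict (part c i) (m i)
  V i = verdict (mads i)

  tally′ : (∀ i → Σ Shape λ σ → HasShape (part c i) σ × countEdges (part c i) ≡ size σ × loss (V i) ≡ deficit σ) →
    Tally c (sum (loss ∘ V))
  tally′ small = subst (Tally c) (sym loss≡) record
    { multiset = σ , (λ i → proj₁ (proj₂ (small i))) , refl , refl , refl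
    ; parts    = count-shapes σ
    ; total    = trans (sum-sizes σ) size≡ }
    where
    σ = proj₁ ∘ small

    loss≡ : sum (loss ∘ V) ≡ count (isP3 ∘ σ)
    loss≡ = trans (sum-cong-≗ (λ i → proj₂ (proj₂ (proj₂ (small i))))) (sym (count≡sum (isP3 ∘ σ)))

    size≡ : sum (size ∘ σ) ≡ n C 2
    size≡ = trans (sum-cong-≗ (λ i → sym (proj₁ (proj₂ (proj₂ (small i)))))) (sum-parts c)

-- Mad sums of explicit partitions

Unique-++⁻ : ∀ (xs : List A) {ys} → Unique (xs ++ ys) →
  Unique xs × Unique ys × (∀ {x} → x ∈ xs → x ∈ ys → ⊥)
Unique-++⁻ []       ys!        = [] , ys! , λ ()
Unique-++⁻ (x ∷ xs) (x∉ ∷ xys!) =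
  let (xs! , ys! , disj) = Unique-++⁻ xs xys! in
  All.tabulate (λ y∈ → All.lookup x∉ (∈-++⁺ˡ y∈)) ∷ xs! , ys! ,
  λ { (here refl) y∈ → All.lookup x∉ (∈-++⁺ʳ xs y∈) refl ; (there x∈) y∈ → disj x∈ y∈ }

module _ {f : A → List B} where

  Unique-lookup : ∀ xs → Unique (concatMap f xs) → ∀ i → Unique (f (lookup xs i))
  Unique-lookup (x ∷ xs) u zero    = proj₁ (Unique-++⁻ (f x) u)
  Unique-lookup (x ∷ xs) u (suc i) = Unique-lookup xs (proj₁ (proj₂ (Unique-++⁻ (f x) u))) i

  ∈-concatMap-lookup : ∀ {y} xs i → y ∈ f (lookup xs i) → y ∈ concatMap f xs
  ∈-concatMap-lookup (x ∷ xs) zero    y∈ = ∈-++⁺ˡ y∈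
  ∈-concatMap-lookup (x ∷ xs) (suc i) y∈ = ∈-++⁺ʳ (f x) (∈-concatMap-lookup xs i y∈)

  Unique-index : ∀ {y} xs → Unique (concatMap f xs) → ∀ i j → y ∈ f (lookup xs i) → y ∈ f (lookup xs j) → i ≡ j
  Unique-index (x ∷ xs) u zero    zero    _  _  = refl
  Unique-index (x ∷ xs) u zero    (suc j) y∈ y∈′ =
    ⊥-elim (proj₂ (proj₂ (Unique-++⁻ (f x) u)) y∈ (∈-concatMap-lookup xs j y∈′))
  Unique-index (x ∷ xs) u (suc i) zero    y∈ y∈′ =
    ⊥-elim (proj₂ (proj₂ (Unique-++⁻ (f x) u)) y∈′ (∈-concatMap-lookup xs i y∈))
  Unique-index (x ∷ xs) u (suc i) (suc j) y∈ y∈′ =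
    cong suc (Unique-index xs (proj₁ (proj₂ (Unique-++⁻ (f x) u))) i j y∈ y∈′)

count-lookup : ∀ (P : A → Bool) xs → count (λ i → P (lookup xs i)) ≡ length (select P xs)
count-lookup P []       = refl
count-lookup P (x ∷ xs) = trans (cong (_+_ (indicator (P x))) (count-lookup P xs)) (sym (length-select-∷ P x xs))

sumℚ-sixth : (u : Fin k → ℕ) → sumℚ (λ i → sixth (u i)) ≡ sixth (sum u)
sumℚ-sixth {zero}  u = fraction-≡ 0 0 0 5 refl
sumℚ-sixth {suc k} u = trans (cong (ℚ._+_ (sixth (u zero))) (sumℚ-sixth (u ∘ suc))) (sixth-+ (u zero) _)

weight+deficit : ∀ σ → weight σ + deficit σ ≡ 3 * size σ + 3
weight+deficit k2 = refl
weight+deficit k3 = refl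
weight+deficit p3 = refl

record Piece (n : ℕ) : Set where
  field
    pieceEdges : List (Edge n)
    shape      : Shape
    isShape    : IsShape pieceEdges shape

open Piece

allEdges : List (Piece n) → List (Edge n)
allEdges = concatMap pieceEdges

#P₃ : List (Piece n) → ℕ
#P₃ ps = length (select (isP3 ∘ shape) ps)

-- A partition whose Mad sum is `d` sixths short of (N + k)/2, with N = n C 2.
HasMadSum : ∀ n k → ℕ → Set
HasMadSum n k d = Σ (Edge n → Fin k) λ c → Σ (Fin k → ℚ) λ m → MadSum c m ×
  Σ ℕ λ W → sumℚ m ≡ sixth W × W + d ≡ 3 * (n C 2) + 3 * k

module _ (ps : List (Piece n)) (ps! : Unique (allEdges ps)) (cover : ∀ e → e ∈ allEdges ps) where
  private
    locate : ∀ e → Any (λ p → e ∈ pieceEdges p) ps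
    locate e = ∈-concatMap⁻ pieceEdges {xs = ps} (cover e)

    c : Edge n → Fin (length ps)
    c e = Any.index (locate e)

    σ : Fin (length ps) → Shape
    σ i = shape (lookup ps i)

    c-EdgeSet : ∀ i → EdgeSet (part c i) (pieceEdges (lookup ps i))
    c-EdgeSet i = edgeSet sound′ complete′
      where
      sound′ : ∀ {e} → e ∈ pieceEdges (lookup ps i) → part c i e ≡ true
      sound′ {e} e∈ with c e Fin.≟ i
      ... | yes _  = refl
      ... | no c≢i = contradiction (Unique-index ps ps! (c e) i (lookup-index (locate e)) e∈) c≢i

      complete′ : ∀ {e} → part c i e ≡ true → e ∈ pieceEdges (lookup ps i)
      complete′ {e} eq with c e Fin.≟ i
      ... | yes refl = lookup-index (locate e)

    size≡ : ∀ i → size (σ i) ≡ countEdges (part c i)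
    size≡ i = sym (trans (EdgeSet.countEdges≡ (c-EdgeSet i) (Unique-lookup ps ps! i)) (length≡size (isShape (lookup ps i))))

  partition-MadSum : HasMadSum n (length ps) (#P₃ ps)
  partition-MadSum = c , (λ i → sixth (weight (σ i))) ,
    (λ i → shape-IsMad (c-EdgeSet i) (Unique-lookup ps ps! i) (isShape (lookup ps i))) ,
    sum (weight ∘ σ) , sumℚ-sixth (weight ∘ σ) , (begin
      sum (weight ∘ σ) + #P₃ ps
        ≡⟨ cong (_+_ (sum (weight ∘ σ))) (trans (sym (count-lookup (isP3 ∘ shape) ps)) (count≡sum (isP3 ∘ σ))) ⟩
      sum (weight ∘ σ) + sum (deficit ∘ σ)         ≡⟨ ∑-distrib-+ (weight ∘ σ) (deficit ∘ σ) ⟨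
      sum (λ i → weight (σ i) + deficit (σ i))     ≡⟨ sum-cong-≗ (weight+deficit ∘ σ) ⟩
      sum (λ i → 3 * size (σ i) + 3)               ≡⟨ ∑-distrib-+ (λ i → 3 * size (σ i)) (λ _ → 3) ⟩
      sum (λ i → 3 * size (σ i)) + sum {length ps} (λ _ → 3)
        ≡⟨ cong₂ _+_ (trans (sum-* 3 (size ∘ σ)) (cong (3 *_) (trans (sum-cong-≗ size≡) (sum-parts c))))
                     (trans (sum-const (length ps) 3) (ℕ.*-comm (length ps) 3)) ⟩
      3 * (n C 2) + 3 * length ps                  ∎)
    where open ≡-Reasoning

singlePiece : Edge n → Piece n
singlePiece e = record { pieceEdges = e ∷ [] ; shape = k2 ; isShape = k2 e }

allEdges-single : (es : List (Edge n)) → allEdges (map singlePiece es) ≡ es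
allEdges-single []       = refl
allEdges-single (e ∷ es) = cong (e ∷_) (allEdges-single es)

#P₃-single : (es : List (Edge n)) → #P₃ (map singlePiece es) ≡ 0
#P₃-single []       = refl
#P₃-single (e ∷ es) = #P₃-single es

module _ (es : List (Edge n)) where
  private
    ∉es? : ∀ e → Dec (e ∉ es)
    ∉es? e = ¬? (Any.any? (e ≟ᴱ_) es)

  uncovered : List (Edge n)
  uncovered = filter ∉es? (edges n)

  uncovered-Unique : Unique uncovered
  uncovered-Unique = Unique.filter⁺ ∉es? (edges-Unique n)

  ∈-uncovered⁻ : ∀ {e} → e ∈ uncovered → e ∉ es
  ∈-uncovered⁻ = proj₂ ∘ ∈-filter⁻ ∉es? {xs = edges n}

  ++-uncovered-Unique : Unique es → Unique (es ++ uncovered)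
  ++-uncovered-Unique es! = Unique.++⁺ es! uncovered-Unique λ (e∈ , e∈′) → ∈-uncovered⁻ e∈′ e∈

  ++-uncovered-complete : ∀ e → e ∈ es ++ uncovered
  ++-uncovered-complete e with Any.any? (e ≟ᴱ_) es
  ... | yes e∈ = ∈-++⁺ˡ e∈
  ... | no  e∉ = ∈-++⁺ʳ es (∈-filter⁺ ∉es? (edges-complete e) e∉)

  length-uncovered : Unique es → length es + length uncovered ≡ n C 2
  length-uncovered es! = trans (sym (List.length-++ es)) (trans (ℕ.≤-antisym
    (length-Unique-⊆ (++-uncovered-Unique es!) (λ {e} _ → edges-complete e))
    (length-Unique-⊆ (edges-Unique n) (λ {e} _ → ++-uncovered-complete e))) (length-edges n))

-- Every edge left over becomes a part K₂, which loses nothing, so the loss is still the number of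
-- paths among `ps`.
extend-MadSum : (ps : List (Piece n)) → Unique (allEdges ps) →
  HasMadSum n (length ps + length (uncovered (allEdges ps))) (#P₃ ps)
extend-MadSum {n} ps ps! = subst₂ (HasMadSum n)
  (trans (List.length-++ ps) (cong (_+_ (length ps)) (List.length-map singlePiece rest)))
  (trans (length-select-++ (isP3 ∘ shape) ps (map singlePiece rest))
    (trans (cong (_+_ (#P₃ ps)) (#P₃-single rest)) (ℕ.+-identityʳ _)))
  (partition-MadSum (ps ++ map singlePiece rest)
    (subst Unique (sym all≡) (++-uncovered-Unique (allEdges ps) ps!))
    (λ e → subst (e ∈_) (sym all≡) (++-uncovered-complete (allEdges ps) e)))
  where
  rest = uncovered (allEdges ps)
  all≡ : allEdges (ps ++ map singlePiece rest) ≡ allEdges ps ++ rest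
  all≡ = trans (List.concatMap-++ pieceEdges ps (map singlePiece rest)) (cong (allEdges ps ++_) (allEdges-single rest))

ends : Edge n → List (Fin n)
ends (u , v , _) = u ∷ v ∷ []

∈-ends : ∀ (e : Edge n) {x} → x ∈ ends e → ∃ λ y → Joins e x y
∈-ends (u , v , _) (here refl)         = v , inj₁ (refl , refl)
∈-ends (u , v , _) (there (here refl)) = u , inj₂ (refl , refl)

Path : List (Edge n) → Set
Path es = ∃ λ e → ∃ λ f → e ∈ es × f ∈ es × e ≢ f × IsShape (e ∷ f ∷ []) p3

path-at : ∀ {e : Edge n} {es y x} → All (e ≢_) es → Joins e y x → x ∈ concatMap ends es → Path (e ∷ es)
path-at {e = e} {es} e∉ yx x∈ with find (∈-concatMap⁻ ends {xs = es} x∈)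
... | f , f∈ , x∈f with ∈-ends f x∈f
... | z , xz = e , f , here refl , there f∈ , All.lookup e∉ f∈ ,
  p3 yx xz λ { refl → All.lookup e∉ f∈ (Joins-unique {e = e} {f} yx (Joins-sym f xz)) }

-- An edge added to a matching either meets an endpoint already used, which gives a path, or leaves
-- all endpoints distinct.
path-or-matching : (es : List (Edge n)) → Unique es →
  Path es ⊎ Unique (concatMap ends es)
path-or-matching [] _ = inj₂ []
path-or-matching {n} (e@(u , v , u<v) ∷ es) (e∉ ∷ es!)
  with Any.any? (u Fin.≟_) (concatMap ends es) | Any.any? (v Fin.≟_) (concatMap ends es) | path-or-matching es es!
... | yes u∈ | _ | _ = inj₁ (path-at e∉ (inj₂ (refl , refl)) u∈)
... | no u∉ | yes v∈ | _ = inj₁ (path-at e∉ (inj₁ (refl , refl)) v∈)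
... | no _ | no _ | inj₁ (e′ , f , e∈ , f∈ , path) = inj₁ (e′ , f , there e∈ , there f∈ , path)
... | no u∉ | no v∉ | inj₂ m! = inj₂ (∉⇒Unique-∷ u∉′ (∉⇒Unique-∷ v∉ m!))
  where
  u∉′ : u ∉ v ∷ concatMap ends es
  u∉′ (here refl) = ℕ.<-irrefl refl u<v
  u∉′ (there u∈)  = u∉ u∈

length-ends : (es : List (Edge n)) → length (concatMap ends es) ≡ 2 * length es
length-ends []       = refl
length-ends (e ∷ es) = trans (cong (_+_ 2) (length-ends es)) (sym (ℕ.*-suc 2 (length es)))

-- A matching with l edges has 2l distinct endpoints, too many for n vertices.
path-exists : (es : List (Edge n)) → Unique es → n < 2 * length es → Path es
path-exists {n} es es! n<2l with path-or-matching es es!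
... | inj₁ path = path
... | inj₂ m!   = contradiction n<2l (ℕ.≤⇒≯ (subst₂ _≤_ (length-ends es) (List.length-tabulate {n = n} id)
                    (length-Unique-⊆ m! (λ {x} _ → ∈-allFin x))))

-- Triangle packings and vertex deletion

record Packing (n s : ℕ) : Set where
  constructor packing
  field
    pieces    : List (Piece n)
    triangles : All (λ p → shape p ≡ k3) pieces
    disjoint  : Unique (allEdges pieces)
    size≡     : length pieces ≡ s

take-Packing : ∀ {s t} → Packing n t → s ≤ t → Packing n s
take-Packing {s = s} (packing ps k3s ps! refl) s≤t = packing (take s ps) (All.take⁺ s k3s)
  (proj₁ (Unique-++⁻ (allEdges (take s ps)) (subst Unique split ps!)))
  (trans (List.length-take s ps) (ℕ.m≤n⇒m⊓n≡m s≤t))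
  where
  split : allEdges ps ≡ allEdges (take s ps) ++ allEdges (drop s ps)
  split = trans (cong allEdges (sym (List.take++drop≡id s ps))) (List.concatMap-++ pieceEdges (take s ps) (drop s ps))

length-allEdges : ∀ (ps : List (Piece n)) → All (λ p → shape p ≡ k3) ps → length (allEdges ps) ≡ 3 * length ps
length-allEdges []       []         = refl
length-allEdges (p ∷ ps) (k3≡ ∷ k3s) = trans (List.length-++ (pieceEdges p)) (trans
  (cong₂ _+_ (trans (length≡size (isShape p)) (cong size k3≡)) (length-allEdges ps k3s))
  (sym (ℕ.*-suc 3 (length ps))))

#P₃-triangles : ∀ (ps : List (Piece n)) → All (λ p → shape p ≡ k3) ps → #P₃ ps ≡ 0
#P₃-triangles []       []          = refl
#P₃-triangles (p ∷ ps) (k3≡ ∷ k3s) = trans (length-select-∷ (isP3 ∘ shape) p ps)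
  (trans (cong (λ σ → indicator (isP3 σ) + #P₃ ps) k3≡) (#P₃-triangles ps k3s))

trianglePiece : ∀ (e f g : Edge n) {a b c} → Joins e a b → Joins f b c → Joins g a c → Piece n
trianglePiece e f g ab bc ac = record { pieceEdges = e ∷ f ∷ g ∷ [] ; shape = k3 ; isShape = k3 ab bc ac }

shift : Edge n → Edge (suc n)
shift (u , v , u<v) = suc u , suc v , s≤s u<v

unshift : ∀ (e : Edge (suc n)) {a b} → Joins e (suc a) (suc b) → Σ (Edge n) λ e′ → Joins e′ a b × shift e′ ≡ e
unshift (suc u , suc v , s≤s u<v) (inj₁ (refl , refl)) = (u , v , u<v) , inj₁ (refl , refl) , refl
unshift (suc u , suc v , s≤s u<v) (inj₂ (refl , refl)) = (u , v , u<v) , inj₂ (refl , refl) , refl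

spoke : Fin n → Edge (suc n)
spoke v = zero , suc v , s≤s z≤n

spoke-Joins : ∀ {e : Edge (suc n)} {v} → Joins e zero (suc v) → e ≡ spoke v
spoke-Joins {e = e} {v} j = Joins-unique {e = e} {spoke v} j (inj₁ (refl , refl))

-- The effect of deleting vertex 0: each lost triangle uses two of the n spokes.
record Deletion (ps : List (Piece (suc n))) : Set where
  field
    kept        : List (Piece n)
    kept-k3     : All (λ p → shape p ≡ k3) kept
    kept-Unique : Unique (allEdges kept)
    kept-⊆      : ∀ {e} → e ∈ allEdges kept → shift e ∈ allEdges ps
    lost        : ℕ
    spokes      : List (Fin n)
    spokes≡     : length spokes ≡ 2 * lost
    spokes-Unique : Unique spokes
    spokes-⊆    : ∀ {v} → v ∈ spokes → spoke v ∈ allEdges ps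
    kept+lost   : length kept + lost ≡ length ps

module _ {ps : List (Piece (suc n))} (D : Deletion ps) (p : Piece (suc n))
         (disj : ∀ {e} → e ∈ pieceEdges p → e ∈ allEdges ps → ⊥) where
  open Deletion D

  drop-triangle : ∀ {u v} → u ≢ v → spoke u ∈ pieceEdges p → spoke v ∈ pieceEdges p → Deletion (p ∷ ps)
  drop-triangle {u} {v} u≢v u∈ v∈ = record
    { kept          = kept
    ; kept-k3       = kept-k3
    ; kept-Unique   = kept-Unique
    ; kept-⊆        = ∈-++⁺ʳ (pieceEdges p) ∘ kept-⊆
    ; lost          = suc lost
    ; spokes        = u ∷ v ∷ spokes
    ; spokes≡       = trans (cong (_+_ 2) spokes≡) (sym (ℕ.*-suc 2 lost))
    ; spokes-Unique = ∉⇒Unique-∷ (λ { (here u≡v) → u≢v u≡v ; (there u∈s) → disj u∈ (spokes-⊆ u∈s) })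
                        (∉⇒Unique-∷ (disj v∈ ∘ spokes-⊆) spokes-Unique)
    ; spokes-⊆      = λ { (here refl) → ∈-++⁺ˡ u∈ ; (there (here refl)) → ∈-++⁺ˡ v∈
                        ; (there (there w∈)) → ∈-++⁺ʳ (pieceEdges p) (spokes-⊆ w∈) }
    ; kept+lost     = trans (ℕ.+-suc _ _) (cong suc kept+lost) }

  keep-triangle : (p′ : Piece n) → shape p′ ≡ k3 → map shift (pieceEdges p′) ≡ pieceEdges p →
    Unique (pieceEdges p) → Deletion (p ∷ ps)
  keep-triangle p′ k3≡ shift≡ p! = record
    { kept          = p′ ∷ kept
    ; kept-k3       = k3≡ ∷ kept-k3
    ; kept-Unique   = Unique.++⁺ (Unique.map⁻ (subst Unique (sym shift≡) p!)) kept-Unique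
                        λ (e∈ , e∈′) → disj (shifted e∈) (kept-⊆ e∈′)
    ; kept-⊆        = λ e∈ → case ∈-++⁻ (pieceEdges p′) e∈ of λ
                        { (inj₁ e∈₁) → ∈-++⁺ˡ (shifted e∈₁) ; (inj₂ e∈₂) → ∈-++⁺ʳ (pieceEdges p) (kept-⊆ e∈₂) }
    ; lost          = lost
    ; spokes        = spokes
    ; spokes≡       = spokes≡
    ; spokes-Unique = spokes-Unique
    ; spokes-⊆      = ∈-++⁺ʳ (pieceEdges p) ∘ spokes-⊆
    ; kept+lost     = cong suc kept+lost }
    where
    shifted : ∀ {e} → e ∈ pieceEdges p′ → shift e ∈ pieceEdges p
    shifted e∈ = subst (_ ∈_) shift≡ (∈-map⁺ shift e∈)

  delete-triangle : IsShape (pieceEdges p) k3 → Unique (pieceEdges p) → Deletion (p ∷ ps)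
  delete-triangle sh p! = go sh refl
    where
    go : ∀ {es} → IsShape es k3 → es ≡ pieceEdges p → Deletion (p ∷ ps)
    go (k3 {e} {a = zero} {zero} ab _ _) _ = contradiction refl (Joins-≢ e ab)
    go (k3 {f = f} {b = zero} {zero} _ bc _) _ = contradiction refl (Joins-≢ f bc)
    go (k3 {g = g} {a = zero} {c = zero} _ _ ac) _ = contradiction refl (Joins-≢ g ac)
    go (k3 {f = f} {a = zero} {suc b} {suc c} ab bc ac) es≡ = drop-triangle (Joins-≢ f bc ∘ cong suc)
      (subst (_ ∈_) es≡ (here (sym (spoke-Joins ab)))) (subst (_ ∈_) es≡ (there (there (here (sym (spoke-Joins ac))))))
    go (k3 {e} {g = g} {a = suc a} {zero} {suc c} ab bc ac) es≡ = drop-triangle (Joins-≢ g ac ∘ cong suc)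
      (subst (_ ∈_) es≡ (here (sym (spoke-Joins (Joins-sym e ab))))) (subst (_ ∈_) es≡ (there (here (sym (spoke-Joins bc)))))
    go (k3 {e} {f} {g} {a = suc a} {suc b} {zero} ab bc ac) es≡ = drop-triangle (Joins-≢ e ab ∘ cong suc)
      (subst (_ ∈_) es≡ (there (there (here (sym (spoke-Joins (Joins-sym g ac)))))))
      (subst (_ ∈_) es≡ (there (here (sym (spoke-Joins (Joins-sym f bc))))))
    go (k3 {e} {f} {g} {a = suc a} {suc b} {suc c} ab bc ac) es≡
      with unshift e ab | unshift f bc | unshift g ac
    ... | e′ , ab′ , refl | f′ , bc′ , refl | g′ , ac′ , refl = keep-triangle (trianglePiece e′ f′ g′ ab′ bc′ ac′) refl es≡ p!

delete : (ps : List (Piece (suc n))) → All (λ p → shape p ≡ k3) ps → Unique (allEdges ps) → Deletion ps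
delete [] _ _ = record
  { kept = [] ; kept-k3 = [] ; kept-Unique = [] ; kept-⊆ = λ () ; lost = 0 ; spokes = [] ; spokes≡ = refl
  ; spokes-Unique = [] ; spokes-⊆ = λ () ; kept+lost = refl }
delete (p ∷ ps) (k3≡ ∷ k3s) p!ps! =
  let (p! , ps! , disj) = Unique-++⁻ (pieceEdges p) p!ps! in
  delete-triangle (delete ps k3s ps!) p disj (subst (IsShape (pieceEdges p)) k3≡ (isShape p)) p!

-- The lost triangles account for 2 · `lost` distinct spokes out of n, so at most n/2 triangles are
-- lost.
delete-vertex : ∀ {s} → Packing (suc n) s → Σ ℕ λ t → Packing n t × 2 * s ≤ 2 * t + n
delete-vertex {n} {s} (packing ps k3s ps! size≡) = length kept , packing kept kept-k3 kept-Unique refl ,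
  subst (λ s → 2 * s ≤ 2 * length kept + n) (trans kept+lost size≡)
    (subst (_≤ 2 * length kept + n) (sym (ℕ.*-distribˡ-+ 2 (length kept) lost))
      (ℕ.+-monoʳ-≤ (2 * length kept) (subst₂ _≤_ spokes≡ (List.length-tabulate {n = n} id)
        (length-Unique-⊆ spokes-Unique (λ {v} _ → ∈-allFin v)))))
  where open Deletion (delete ps k3s ps!)

-- Edge-disjointness through edge codes

next prev : Fin 3 → Fin 3
next 0F = 1F
next 1F = 2F
next 2F = 0F
prev 0F = 2F
prev 1F = 0F
prev 2F = 1F

prev-next : ∀ i → prev (next i) ≡ i
prev-next 0F = refl
prev-next 1F = refl
prev-next 2F = refl

next≢ : ∀ i → next i ≢ i
next≢ 0F ()
next≢ 1F ()
next≢ 2F ()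

next²≢ : ∀ i → next (next i) ≢ i
next²≢ 0F ()
next²≢ 1F ()
next²≢ 2F ()

length-cartesianProductWith : ∀ {C : Set} (f : A → B → C) xs ys →
  length (cartesianProductWith f xs ys) ≡ length xs * length ys
length-cartesianProductWith f []       ys = refl
length-cartesianProductWith f (x ∷ xs) ys = trans (List.length-++ (map (f x) ys))
  (cong₂ _+_ (List.length-map (f x) ys) (length-cartesianProductWith f xs ys))

↑ˡ≢↑ʳ : ∀ {m n} (i : Fin m) (j : Fin n) → i Fin.↑ˡ n ≢ m Fin.↑ʳ j
↑ˡ≢↑ʳ {m} {n} i j eq with () ← trans (sym (Fin.splitAt-↑ˡ m i n)) (trans (cong (Fin.splitAt m) eq) (Fin.splitAt-↑ʳ m n j))

-- `op i` leads from level i to level i + 1. Commutativity lets the two slanted edges of a main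
-- triangle meet; cancellation makes the slanted edges at a point distinct. The dependence on i
-- leaves room for a product that is twisted on one level only.
module Construction {q j : ℕ} (op : Fin 3 → Fin q → Fin q → Fin q)
  (op-comm : ∀ i x y → op i x y ≡ op i y x)
  (op-cancel : ∀ i x {y z} → op i x y ≡ op i x z → y ≡ z) where

  data Point : Set where
    at : Fin 3 → Fin q → Point
    ∞  : Fin j → Point

  at-injective : ∀ {i i′ x x′} → at i x ≡ at i′ x′ → i ≡ i′ × x ≡ x′
  at-injective refl = refl , refl

  num : Point → Fin (3 * q + j)
  num (at i x) = Fin.combine i x Fin.↑ˡ j
  num (∞ y)    = (3 * q) Fin.↑ʳ y

  num-injective : ∀ P Q → num P ≡ num Q → P ≡ Q
  num-injective (at i x) (at i′ x′) eq =
    let (i≡ , x≡) = Fin.combine-injective i x i′ x′ (Fin.↑ˡ-injective j _ _ eq) in cong₂ at i≡ x≡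
  num-injective (∞ y)    (∞ y′)     eq = cong ∞ (Fin.↑ʳ-injective (3 * q) _ _ eq)
  num-injective (at i x) (∞ y)      eq = contradiction eq (↑ˡ≢↑ʳ (Fin.combine i x) y)
  num-injective (∞ y)    (at i x)   eq = contradiction (sym eq) (↑ˡ≢↑ʳ (Fin.combine i x) y)

  -- Names of edges. A slanted edge is named by both factors and not by its far end, so the pair {x,
  -- y} of its main triangle can be read off.
  data Code : Set where
    flat  : Fin 3 → Edge q → Code
    slant : Fin 3 → Fin q → Fin q → Code
    inf   : Fin j → Fin 3 → Fin q → Code
    infs  : Edge j → Code

  src tgt : Code → Point
  src (flat i (x , _)) = at i x
  src (slant i x _)    = at i x
  src (inf y _ _)      = ∞ y
  src (infs (y , _))   = ∞ y
  tgt (flat i (_ , y , _)) = at i y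
  tgt (slant i x y)        = at (next i) (op i x y)
  tgt (inf _ i x)          = at i x
  tgt (infs (_ , z , _))   = ∞ z

  src≢tgt : ∀ c → src c ≢ tgt c
  src≢tgt (flat i (x , y , x<y)) eq = ℕ.<-irrefl (cong Fin.toℕ (proj₂ (at-injective eq))) x<y
  src≢tgt (slant i x y)          eq = next≢ i (sym (proj₁ (at-injective eq)))
  src≢tgt (inf _ _ _)            ()
  src≢tgt (infs (y , z , y<z)) refl = ℕ.<-irrefl refl y<z

  same-ends : ∀ c d → src c ≡ src d → tgt c ≡ tgt d → c ≡ d
  same-ends (flat i _) (flat i′ _) s t with refl ← proj₁ (at-injective s) =
    cong (flat i) (Edge-≡ (proj₂ (at-injective s)) (proj₂ (at-injective t)))
  same-ends (flat i _) (slant i′ _ _) s t with refl ← proj₁ (at-injective s) =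
    contradiction (sym (proj₁ (at-injective t))) (next≢ i)
  same-ends (flat _ _) (inf _ _ _) () _
  same-ends (flat _ _) (infs _) () _
  same-ends (slant i _ _) (flat i′ _) s t with refl ← proj₁ (at-injective s) =
    contradiction (proj₁ (at-injective t)) (next≢ i)
  same-ends (slant i x _) (slant _ _ _) s t with refl , refl ← at-injective s =
    cong (slant i x) (op-cancel i x (proj₂ (at-injective t)))
  same-ends (slant _ _ _) (inf _ _ _) () _
  same-ends (slant _ _ _) (infs _) () _
  same-ends (inf _ _ _) (flat _ _) () _
  same-ends (inf _ _ _) (slant _ _ _) () _
  same-ends (inf _ _ _) (inf _ _ _) refl refl = refl
  same-ends (inf _ _ _) (infs _) _ ()
  same-ends (infs _) (flat _ _) () _
  same-ends (infs _) (slant _ _ _) () _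
  same-ends (infs _) (inf _ _ _) _ ()
  same-ends (infs _) (infs _) refl refl = cong infs (Edge-≡ refl refl)

  -- The decisive case is that of two slanted edges: running in opposite directions they would need
  -- i + 2 = i, which fails in ℤ/3.
  swapped-ends : ∀ c d → src c ≡ tgt d → tgt c ≡ src d → c ≡ d
  swapped-ends (flat _ (_ , _ , p)) (flat _ (_ , _ , p′)) refl refl = contradiction p′ (ℕ.<-asym p)
  swapped-ends (flat i _) (slant i′ _ _) s t with refl ← proj₁ (at-injective t) =
    contradiction (sym (proj₁ (at-injective s))) (next≢ i)
  swapped-ends (flat _ _) (inf _ _ _) _ ()
  swapped-ends (flat _ _) (infs _) () _
  swapped-ends (slant i _ _) (flat _ _) s t with refl ← proj₁ (at-injective s) =
    contradiction (proj₁ (at-injective t)) (next≢ i)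
  swapped-ends (slant _ _ _) (slant i′ _ _) s t with refl ← proj₁ (at-injective s) =
    contradiction (proj₁ (at-injective t)) (next²≢ i′)
  swapped-ends (slant _ _ _) (inf _ _ _) _ ()
  swapped-ends (slant _ _ _) (infs _) () _
  swapped-ends (inf _ _ _) (flat _ _) () _
  swapped-ends (inf _ _ _) (slant _ _ _) () _
  swapped-ends (inf _ _ _) (inf _ _ _) () _
  swapped-ends (inf _ _ _) (infs _) _ ()
  swapped-ends (infs _) (flat _ _) () _
  swapped-ends (infs _) (slant _ _ _) () _
  swapped-ends (infs _) (inf _ _ _) () _
  swapped-ends (infs (_ , _ , p)) (infs (_ , _ , p′)) refl refl = contradiction p′ (ℕ.<-asym p)

  codeEdge : Code → Edge (3 * q + j)
  codeEdge c = edge (num (src c)) (num (tgt c)) (src≢tgt c ∘ num-injective (src c) (tgt c))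

  codeEdge-joins : ∀ c → Joins (codeEdge c) (num (src c)) (num (tgt c))
  codeEdge-joins c = edge-joins (num (src c)) (num (tgt c)) _

  codeEdge-injective : ∀ {c d} → codeEdge c ≡ codeEdge d → c ≡ d
  codeEdge-injective {c} {d} eq with codeEdge-joins c | subst (λ e → Joins e (num (src d)) (num (tgt d))) (sym eq) (codeEdge-joins d)
  ... | inj₁ (u≡ , v≡) | inj₁ (u≡′ , v≡′) = same-ends c d
      (num-injective _ _ (trans (sym u≡) u≡′)) (num-injective _ _ (trans (sym v≡) v≡′))
  ... | inj₂ (u≡ , v≡) | inj₂ (u≡′ , v≡′) = same-ends c d
      (num-injective _ _ (trans (sym v≡) v≡′)) (num-injective _ _ (trans (sym u≡) u≡′))
  ... | inj₁ (u≡ , v≡) | inj₂ (u≡′ , v≡′) = swapped-ends c d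
      (num-injective _ _ (trans (sym u≡) u≡′)) (num-injective _ _ (trans (sym v≡) v≡′))
  ... | inj₂ (u≡ , v≡) | inj₁ (u≡′ , v≡′) = swapped-ends c d
      (num-injective _ _ (trans (sym v≡) v≡′)) (num-injective _ _ (trans (sym u≡) u≡′))

  -- `main` is the Bose-Skolem triangle of a pair; `vert x` is the column (0, x) (1, x) (2, x);
  -- `link y i x` joins the point y at infinity to (i, x) and (i + 1, x ∙ x); `apex` joins two
  -- points at infinity to (0, x).
  data Triangle : Set where
    main : Fin 3 → Edge q → Triangle
    vert : Fin q → Triangle
    link : Fin j → Fin 3 → Fin q → Triangle
    apex : Edge j → Fin q → Triangle

  vert-injective : ∀ {x x′} → vert x ≡ vert x′ → x ≡ x′
  vert-injective refl = refl

  link-injective : ∀ {y y′ i i′ x x′} → link y i x ≡ link y′ i′ x′ → y ≡ y′ × i ≡ i′ × x ≡ x′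
  link-injective refl = refl , refl , refl

  codes : Triangle → List Code
  codes (main i e@(x , y , _)) = flat i e ∷ slant i y x ∷ slant i x y ∷ []
  codes (vert x)               = slant 0F x x ∷ slant 1F x x ∷ slant 2F x x ∷ []
  codes (link y i x)           = inf y i x ∷ slant i x x ∷ inf y (next i) (op i x x) ∷ []
  codes (apex e@(y , z , _) x) = infs e ∷ inf z 0F x ∷ inf y 0F x ∷ []

  codes-Unique : ∀ t → Unique (codes t)
  codes-Unique (main i (x , y , x<y)) =
    ((λ ()) ∷ (λ ()) ∷ []) ∷ ((λ { refl → ℕ.<-irrefl refl x<y }) ∷ []) ∷ [] ∷ []
  codes-Unique (vert x) = ((λ ()) ∷ (λ ()) ∷ []) ∷ ((λ ()) ∷ []) ∷ [] ∷ []
  codes-Unique (link y i x) =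
    ((λ ()) ∷ (λ eq → next≢ i (sym (proj₁ (at-injective (cong tgt eq))))) ∷ []) ∷ ((λ ()) ∷ []) ∷ [] ∷ []
  codes-Unique (apex (y , z , y<z) x) =
    ((λ ()) ∷ (λ ()) ∷ []) ∷ ((λ { refl → ℕ.<-irrefl refl y<z }) ∷ []) ∷ [] ∷ []

  -- The three diagonal edges of a column close up only if x is idempotent on every level.
  Valid : Triangle → Set
  Valid (vert x) = ∀ i → op i x x ≡ x
  Valid _        = ⊤

  fromTo : ∀ c {P Q} → src c ≡ P → tgt c ≡ Q → Joins (codeEdge c) (num P) (num Q)
  fromTo c refl refl = codeEdge-joins c

  toFrom : ∀ c {P Q} → src c ≡ Q → tgt c ≡ P → Joins (codeEdge c) (num P) (num Q)
  toFrom c refl refl = Joins-sym (codeEdge c) (codeEdge-joins c)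

  isTriangle : ∀ t → Valid t → IsShape (map codeEdge (codes t)) k3
  isTriangle (main i e@(x , y , _)) _ = k3 (fromTo (flat i e) refl refl)
    (fromTo (slant i y x) refl (cong (at (next i)) (op-comm i y x))) (fromTo (slant i x y) refl refl)
  isTriangle (vert x) idem = k3 (fromTo (slant 0F x x) refl (cong (at 1F) (idem 0F)))
    (fromTo (slant 1F x x) refl (cong (at 2F) (idem 1F))) (toFrom (slant 2F x x) refl (cong (at 0F) (idem 2F)))
  isTriangle (link y i x) _ = k3 (fromTo (inf y i x) refl refl) (fromTo (slant i x x) refl refl)
    (fromTo (inf y (next i) (op i x x)) refl refl)
  isTriangle (apex e@(y , z , _) x) _ = k3 (fromTo (infs e) refl refl) (fromTo (inf z 0F x) refl refl)
    (fromTo (inf y 0F x) refl refl)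

  toPieces : ∀ {ts} → All Valid ts → List (Piece (3 * q + j))
  toPieces []                   = []
  toPieces (_∷_ {x = t} v vs) = record { pieceEdges = map codeEdge (codes t) ; shape = k3 ; isShape = isTriangle t v } ∷ toPieces vs

  allEdges-toPieces : ∀ {ts} (vs : All Valid ts) → allEdges (toPieces vs) ≡ map codeEdge (concatMap codes ts)
  allEdges-toPieces []                 = refl
  allEdges-toPieces (_∷_ {x = t} {ts} v vs) = trans (cong (map codeEdge (codes t) ++_) (allEdges-toPieces vs))
    (sym (List.map-++ codeEdge (codes t) (concatMap codes ts)))

  length-toPieces : ∀ {ts} (vs : All Valid ts) → length (toPieces vs) ≡ length ts
  length-toPieces []       = refl
  length-toPieces (v ∷ vs) = cong suc (length-toPieces vs)

  toPieces-k3 : ∀ {ts} (vs : All Valid ts) → All (λ p → shape p ≡ k3) (toPieces vs)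
  toPieces-k3 []       = []
  toPieces-k3 (v ∷ vs) = refl ∷ toPieces-k3 vs

  mains : List Triangle
  mains = cartesianProductWith main (allFin 3) (edges q)

  -- The triangle containing the edge with a given code, for the edges not in a main triangle.
  module Extras (diagOwner : Fin 3 → Fin q → Triangle) (infOwner : Fin j → Fin 3 → Fin q → Triangle)
                (infsOwner : Edge j → Triangle) where

    -- The tables must send each edge of an extra triangle back to that triangle. The empty case for
    -- `main` keeps the extra triangles apart from the main ones.
    Owned : Triangle → Set
    Owned (main _ _)             = ⊥
    Owned (vert x)               = ∀ i → diagOwner i x ≡ vert x
    Owned (link y i x)           = diagOwner i x ≡ link y i x × infOwner y i x ≡ link y i x ×
                                   infOwner y (next i) (op i x x) ≡ link y i x
    Owned (apex e@(y , z , _) x) = infsOwner e ≡ apex e x × infOwner y 0F x ≡ apex e x × infOwner z 0F x ≡ apex e x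

    owner : Code → Triangle
    owner (flat i e)    = main i e
    owner (slant i x y) with Fin.<-cmp x y
    ... | tri< x<y _ _ = main i (x , y , x<y)
    ... | tri≈ _ _ _   = diagOwner i x
    ... | tri> _ _ y<x = main i (y , x , y<x)
    owner (inf y i x)   = infOwner y i x
    owner (infs e)      = infsOwner e

    owner-diag : ∀ i x → owner (slant i x x) ≡ diagOwner i x
    owner-diag i x with Fin.<-cmp x x
    ... | tri< x<x _ _ = contradiction x<x (ℕ.<-irrefl refl)
    ... | tri≈ _ _ _   = refl
    ... | tri> _ _ x<x = contradiction x<x (ℕ.<-irrefl refl)

    owner-main : ∀ i e {c} → c ∈ codes (main i e) → owner c ≡ main i e
    owner-main i e (here refl) = refl
    owner-main i (x , y , x<y) (there (here refl)) with Fin.<-cmp y x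
    ... | tri< y<x _ _ = contradiction y<x (ℕ.<-asym x<y)
    ... | tri≈ _ y≡x _ = contradiction (cong Fin.toℕ (sym y≡x)) (ℕ.<⇒≢ x<y)
    ... | tri> _ _ _   = cong (main i) (Edge-≡ refl refl)
    owner-main i (x , y , x<y) (there (there (here refl))) with Fin.<-cmp x y
    ... | tri< _ _ _   = cong (main i) (Edge-≡ refl refl)
    ... | tri≈ _ x≡y _ = contradiction (cong Fin.toℕ x≡y) (ℕ.<⇒≢ x<y)
    ... | tri> _ _ y<x = contradiction y<x (ℕ.<-asym x<y)

    owner-extra : ∀ t → Owned t → ∀ {c} → c ∈ codes t → owner c ≡ t
    owner-extra (vert x) own (here refl)                 = trans (owner-diag 0F x) (own 0F)
    owner-extra (vert x) own (there (here refl))         = trans (owner-diag 1F x) (own 1F)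
    owner-extra (vert x) own (there (there (here refl))) = trans (owner-diag 2F x) (own 2F)
    owner-extra (link y i x) (_ , own , _) (here refl)                 = own
    owner-extra (link y i x) (own , _ , _) (there (here refl))         = trans (owner-diag i x) own
    owner-extra (link y i x) (_ , _ , own) (there (there (here refl))) = own
    owner-extra (apex _ x) (own , _ , _) (here refl)                 = own
    owner-extra (apex _ x) (_ , _ , own) (there (here refl))         = own
    owner-extra (apex _ x) (_ , own , _) (there (there (here refl))) = own

    -- Codes are injective names of edges and `owner` recovers the triangle from each of its codes,
    -- so no two triangles share an edge. The count is three main triangles per pair, plus the extra
    -- ones.
    construct : ∀ {extra} → Unique extra → All Valid extra → All Owned extra →
      Packing (3 * q + j) (3 * (q C 2) + length extra)
    construct {extra} extra! valid owned = packing (toPieces vs) (toPieces-k3 vs)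
      (subst Unique (sym (allEdges-toPieces vs)) (Unique.map⁺ codeEdge-injective
        (Unique-concatMap owner ts! codes-Unique own)))
      (trans (length-toPieces vs) (trans (List.length-++ mains) (cong (_+ length extra)
        (trans (length-cartesianProductWith main (allFin 3) (edges q)) (cong (3 *_) (length-edges q))))))
      where
      ∈-mains⁻ : ∀ {t} → t ∈ mains → ∃ λ i → ∃ λ e → t ≡ main i e
      ∈-mains⁻ t∈ with i , e , _ , _ , t≡ ← ∈-cartesianProductWith⁻ main (allFin 3) (edges q) t∈ = i , e , t≡

      vs : All Valid (mains ++ extra)
      vs = All.++⁺ (All.tabulate λ {t} t∈ → case ∈-mains⁻ t∈ of λ { (_ , _ , refl) → tt }) valid

      main-injective : ∀ {i i′ e e′} → main i e ≡ main i′ e′ → i ≡ i′ × e ≡ e′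
      main-injective refl = refl , refl

      ts! : Unique (mains ++ extra)
      ts! = Unique.++⁺ (Unique.cartesianProductWith⁺ main main-injective (Unique.allFin⁺ 3) (edges-Unique q)) extra!
        λ (t∈ , t∈′) → case ∈-mains⁻ t∈ of λ { (_ , _ , refl) → All.lookup owned t∈′ }

      own : ∀ {t c} → t ∈ mains ++ extra → c ∈ codes t → owner c ≡ t
      own {t} t∈ c∈ with ∈-++⁻ mains t∈
      ... | inj₁ t∈₁ with i , e , refl ← ∈-mains⁻ t∈₁ = owner-main i e c∈
      ... | inj₂ t∈₂ = owner-extra t (All.lookup owned t∈₂) c∈

-- The quasigroups

data Parity : ℕ → Set where
  even : ∀ j → Parity (j + j)
  odd  : ∀ j → Parity (suc (j + j))

parity : ∀ m → Parity m
parity zero = even 0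
parity (suc m) with parity m
... | even j = odd j
... | odd  j = subst Parity (cong suc (ℕ.+-suc j j)) (even (suc j))

-- Halving modulo 2h or 2h − 1.
half : ℕ → ℕ → ℕ
half h 0             = 0
half h 1             = h
half h (suc (suc m)) = suc (half h m)

half-even : ∀ h j → half h (j + j) ≡ j
half-even h zero    = refl
half-even h (suc j) = trans (cong (λ m → half h (suc m)) (ℕ.+-suc j j)) (cong suc (half-even h j))

half-odd : ∀ h j → half h (suc (j + j)) ≡ h + j
half-odd h zero    = sym (ℕ.+-identityʳ h)
half-odd h (suc j) = trans (cong (λ m → half h (suc (suc m))) (ℕ.+-suc j j))
  (trans (cong suc (half-odd h j)) (sym (ℕ.+-suc h j)))

-- For r = 1, h is the inverse of 2 modulo q = 2k + 1 and halving is genuine. For r = 0 and q = 2k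
-- there is no inverse: `half` only relabels, with even residues going to the lower half and odd
-- ones to the upper half, which is Skolem's half-idempotent quasigroup.
module Quasigroup (k r : ℕ) (r≤1 : r ≤ 1) where

  q h : ℕ
  q = k + (k + r)
  h = k + r

  odd-small : ∀ j → suc (j + j) < q → j < k
  odd-small j lt = ℕ.≰⇒> λ k≤j → ℕ.<-irrefl refl (ℕ.≤-<-trans (s≤s (ℕ.+-mono-≤ k≤j k≤j)) (ℕ.<-≤-trans lt
    (subst (q ≤_) (trans (cong (_+_ k) (ℕ.+-comm k 1)) (ℕ.+-suc k k)) (ℕ.+-monoʳ-≤ k (ℕ.+-monoʳ-≤ k r≤1)))))

  even-small : ∀ j → j + j < q → j < h
  even-small j lt = ℕ.≰⇒> λ h≤j → ℕ.<-irrefl refl (ℕ.<-≤-trans lt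
    (ℕ.+-mono-≤ (ℕ.≤-trans (ℕ.m≤m+n k r) h≤j) h≤j))

  half-< : ∀ m → m < q → half h m < q
  half-< m m<q with parity m
  ... | even j = subst (_< q) (sym (half-even h j)) (ℕ.≤-<-trans (ℕ.m≤m+n j j) m<q)
  ... | odd  j = subst₂ _<_ (trans (ℕ.+-comm j h) (sym (half-odd h j))) refl (ℕ.+-monoˡ-< h (odd-small j m<q))

  half-injective : ∀ m m′ → m < q → m′ < q → half h m ≡ half h m′ → m ≡ m′
  half-injective m m′ m< m′< eq with parity m | parity m′
  ... | even i | even j = cong (λ i → i + i) (trans (sym (half-even h i)) (trans eq (half-even h j)))
  ... | odd  i | odd  j = cong (λ i → suc (i + i))
      (ℕ.+-cancelˡ-≡ h i j (trans (sym (half-odd h i)) (trans eq (half-odd h j))))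
  ... | even i | odd  j = contradiction (even-small i m<)
      (ℕ.≤⇒≯ (subst (h ≤_) (trans (sym (half-odd h j)) (trans (sym eq) (half-even h i))) (ℕ.m≤m+n h j)))
  ... | odd  i | even j = contradiction (even-small j m′<)
      (ℕ.≤⇒≯ (subst (h ≤_) (trans (sym (half-odd h i)) (trans eq (half-even h j))) (ℕ.m≤m+n h i)))

  reduce : ℕ → ℕ
  reduce m with m <? q
  ... | yes _ = m
  ... | no  _ = m ∸ q

  reduce-< : ∀ {m} → m < q + q → reduce m < q
  reduce-< {m} m<2q with m <? q
  ... | yes m<q = m<q
  ... | no  m≮q = ℕ.+-cancelʳ-< q _ _ (subst (_< q + q) (sym (ℕ.m∸n+n≡m (ℕ.≮⇒≥ m≮q))) m<2q)

  reduce-split : ∀ m → m ≡ reduce m ⊎ m ≡ reduce m + q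
  reduce-split m with m <? q
  ... | yes _   = inj₁ refl
  ... | no  m≮q = inj₂ (sym (ℕ.m∸n+n≡m (ℕ.≮⇒≥ m≮q)))

  reduce-small : ∀ {m} → m < q → reduce m ≡ m
  reduce-small {m} m<q with m <? q
  ... | yes _   = refl
  ... | no  m≮q = contradiction m<q m≮q

  reduce-large : ∀ m → reduce (m + q) ≡ m
  reduce-large m with m + q <? q
  ... | yes lt = contradiction lt (ℕ.≤⇒≯ (ℕ.m≤n+m q m))
  ... | no  _  = ℕ.m+n∸n≡m m q

  -- If only one of the sums wraps around, one of `y`, `z` exceeds the other by q and is out of
  -- range.
  reduce-cancel : ∀ x {y z} → y < q → z < q → reduce (x + y) ≡ reduce (x + z) → y ≡ z
  reduce-cancel x {y} {z} y<q z<q eq with reduce-split (x + y) | reduce-split (x + z)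
  ... | inj₁ p | inj₁ p′ = ℕ.+-cancelˡ-≡ x y z (trans p (trans eq (sym p′)))
  ... | inj₂ p | inj₂ p′ = ℕ.+-cancelˡ-≡ x y z (trans p (trans (cong (_+ q) eq) (sym p′)))
  ... | inj₁ p | inj₂ p′ = contradiction z<q (ℕ.≤⇒≯ (subst (q ≤_)
      (ℕ.+-cancelˡ-≡ x (y + q) z (trans (sym (ℕ.+-assoc x y q)) (trans (cong (_+ q) (trans p eq)) (sym p′)))) (ℕ.m≤n+m q y)))
  ... | inj₂ p | inj₁ p′ = contradiction y<q (ℕ.≤⇒≯ (subst (q ≤_)
      (ℕ.+-cancelˡ-≡ x (z + q) y (trans (sym (ℕ.+-assoc x z q)) (trans (cong (_+ q) (trans p′ (sym eq))) (sym p)))) (ℕ.m≤n+m q z)))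

  _∙_ : Fin q → Fin q → Fin q
  x ∙ y = Fin.fromℕ< (half-< _ (reduce-< (ℕ.+-mono-< (Fin.toℕ<n x) (Fin.toℕ<n y))))

  toℕ-∙ : ∀ x y → Fin.toℕ (x ∙ y) ≡ half h (reduce (Fin.toℕ x + Fin.toℕ y))
  toℕ-∙ x y = Fin.toℕ-fromℕ< _

  ∙-comm : ∀ x y → x ∙ y ≡ y ∙ x
  ∙-comm x y = Fin.toℕ-injective (trans (toℕ-∙ x y)
    (trans (cong (half h ∘ reduce) (ℕ.+-comm (Fin.toℕ x) (Fin.toℕ y))) (sym (toℕ-∙ y x))))

  ∙-cancel : ∀ x {y z} → x ∙ y ≡ x ∙ z → y ≡ z
  ∙-cancel x {y} {z} eq = Fin.toℕ-injective (reduce-cancel (Fin.toℕ x) (Fin.toℕ<n y) (Fin.toℕ<n z)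
    (half-injective _ _ (reduce-< (ℕ.+-mono-< (Fin.toℕ<n x) (Fin.toℕ<n y))) (reduce-< (ℕ.+-mono-< (Fin.toℕ<n x) (Fin.toℕ<n z)))
      (trans (sym (toℕ-∙ x y)) (trans (cong Fin.toℕ eq) (toℕ-∙ x z)))))

  ∙-small : ∀ x → Fin.toℕ x + Fin.toℕ x < q → x ∙ x ≡ x
  ∙-small x lt = Fin.toℕ-injective (trans (toℕ-∙ x x) (trans (cong (half h) (reduce-small lt)) (half-even h (Fin.toℕ x))))

  ∙-large : ∀ x m → Fin.toℕ x + Fin.toℕ x ≡ m + q → Fin.toℕ (x ∙ x) ≡ half h m
  ∙-large x m eq = trans (toℕ-∙ x x) (cong (half h) (trans (cong reduce eq) (reduce-large m)))

  L R : Fin k → Fin q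
  L j = j Fin.↑ˡ (k + r)
  R j = k Fin.↑ʳ (j Fin.↑ˡ r)

  toℕ-L : ∀ j → Fin.toℕ (L j) ≡ Fin.toℕ j
  toℕ-L j = Fin.toℕ-↑ˡ j (k + r)

  toℕ-R : ∀ j → Fin.toℕ (R j) ≡ k + Fin.toℕ j
  toℕ-R j = trans (Fin.toℕ-↑ʳ k (j Fin.↑ˡ r)) (cong (_+_ k) (Fin.toℕ-↑ˡ j r))

  L∙L : ∀ j → L j ∙ L j ≡ L j
  L∙L j = ∙-small (L j) (subst (λ a → a + a < q) (sym (toℕ-L j))
    (ℕ.<-≤-trans (ℕ.+-mono-< (Fin.toℕ<n j) (Fin.toℕ<n j)) (ℕ.+-monoʳ-≤ k (ℕ.m≤m+n k r))))

module EvenQuasigroup (k : ℕ) where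
  open Quasigroup k 0 z≤n public

  -- 2(k + j) leaves the residue 2j modulo 2k, whose half is j.
  R∙R : ∀ j → R j ∙ R j ≡ L j
  R∙R j = Fin.toℕ-injective (trans (∙-large (R j) (a + a) (trans (cong (λ b → b + b) (toℕ-R j))
      (solve 2 (λ k a → (k :+ a) :+ (k :+ a) := (a :+ a) :+ (k :+ (k :+ con 0))) refl k a)))
    (trans (half-even h a) (sym (toℕ-L j))))
    where a = Fin.toℕ j

module OddQuasigroup (k : ℕ) where
  open Quasigroup k 1 (s≤s z≤n) public

  -- For x = h + a the double is q + (2a + 1), and the half of the odd residue 2a + 1 is h + a
  -- again.
  idem : ∀ x → x ∙ x ≡ x
  idem x with Fin.toℕ x <? h
  ... | yes x<h = ∙-small x (ℕ.≤-<-trans (ℕ.+-mono-≤ x≤k x≤k) (ℕ.+-monoʳ-< k (subst (k <_) (ℕ.+-comm 1 k) (ℕ.n<1+n k))))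
    where
    x≤k : Fin.toℕ x ≤ k
    x≤k = s≤s⁻¹ (subst (Fin.toℕ x <_) (ℕ.+-comm k 1) x<h)
  ... | no  x≮h = Fin.toℕ-injective (trans (∙-large x (suc (a + a)) (trans (cong (λ b → b + b) (sym x≡))
      (solve 2 (λ k a → ((k :+ con 1) :+ a) :+ ((k :+ con 1) :+ a) := (con 1 :+ (a :+ a)) :+ (k :+ (k :+ con 1))) refl k a)))
    (trans (half-odd h a) x≡))
    where
    a = Fin.toℕ x ∸ h
    x≡ : h + a ≡ Fin.toℕ x
    x≡ = ℕ.m+[n∸m]≡n (ℕ.≮⇒≥ x≮h)

-- Packings by residue class

↑ˡ-cancel : ∀ {m} n {i j : Fin m} → i Fin.↑ˡ n ≡ j Fin.↑ˡ n → i ≡ j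
↑ˡ-cancel n = Fin.↑ˡ-injective n _ _

-- Only the lower half of the even quasigroup is idempotent, so exactly k columns close up into
-- triangles.
packing-6k : ∀ k → Packing (3 * (k + (k + 0)) + 0) (3 * ((k + (k + 0)) C 2) + k)
packing-6k k = subst (λ l → Packing (3 * q + 0) (3 * (q C 2) + l))
  (trans (List.length-map (vert ∘ L) (allFin k)) (List.length-tabulate {n = k} id))
  (construct (Unique.map⁺ (↑ˡ-cancel (k + 0) ∘ vert-injective) (Unique.allFin⁺ k))
    (All.map⁺ (All.tabulate λ {j} _ _ → L∙L j)) (All.map⁺ (All.tabulate λ _ _ → refl)))
  where
  open EvenQuasigroup k
  open Construction {q} {0} (λ _ → _∙_) (λ _ → ∙-comm) (λ _ → ∙-cancel)
  open Extras (λ _ → vert) (λ ()) (λ ())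

-- All columns close up: this is Bose's Steiner triple system, in which every edge is used.
packing-6k+3 : ∀ k → Packing (3 * (k + (k + 1)) + 0) (3 * ((k + (k + 1)) C 2) + (k + (k + 1)))
packing-6k+3 k = subst (λ l → Packing (3 * q + 0) (3 * (q C 2) + l))
  (trans (List.length-map vert (allFin q)) (List.length-tabulate {n = q} id))
  (construct (Unique.map⁺ vert-injective (Unique.allFin⁺ q))
    (All.map⁺ (All.tabulate λ {x} _ _ → idem x)) (All.map⁺ (All.tabulate λ _ _ → refl)))
  where
  open OddQuasigroup k
  open Construction {q} {0} (λ _ → _∙_) (λ _ → ∙-comm) (λ _ → ∙-cancel)
  open Extras (λ _ → vert) (λ ()) (λ ())

-- Skolem's triangles ∞ (i, k + j) (i + 1, j), which exist because k + j squares to j. They use each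
-- edge at infinity once: the upper point of a level belongs to the spike leaving that level, the
-- lower point to the spike arriving there.
packing-6k+1 : ∀ k → Packing (3 * (k + (k + 0)) + 1) (3 * ((k + (k + 0)) C 2) + 3 * k)
packing-6k+1 k = subst (λ l → Packing (3 * q + 1) (3 * (q C 2) + l))
  (trans (length-cartesianProductWith spike (allFin 3) (allFin k)) (cong (3 *_) (List.length-tabulate {n = k} id)))
  (construct (Unique.cartesianProductWith⁺ spike spike-injective (Unique.allFin⁺ 3) (Unique.allFin⁺ k))
    (All.tabulate λ t∈ → case ∈-cartesianProductWith⁻ spike (allFin 3) (allFin k) t∈ of λ { (_ , _ , _ , _ , refl) → tt })
    (All.tabulate λ t∈ → case ∈-cartesianProductWith⁻ spike (allFin 3) (allFin k) t∈ of λ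
      { (i , j , _ , _ , refl) → refl , right-owner i j , left-owner i j }))
  where
  open EvenQuasigroup k
  open Construction {q} {1} (λ _ → _∙_) (λ _ → ∙-comm) (λ _ → ∙-cancel)

  spike : Fin 3 → Fin k → Triangle
  spike i j = link 0F i (R j)

  infOwner : Fin 1 → Fin 3 → Fin q → Triangle
  infOwner _ i x with Fin.splitAt k x
  ... | inj₁ j = spike (prev i) j
  ... | inj₂ _ = link 0F i x

  noPair : Edge 1 → Triangle
  noPair (0F , 0F , ())

  open Extras (link 0F) infOwner noPair

  spike-injective : ∀ {i i′ j j′} → spike i j ≡ spike i′ j′ → i ≡ i′ × j ≡ j′
  spike-injective eq with _ , i≡ , x≡ ← link-injective eq = i≡ , ↑ˡ-cancel 0 (Fin.↑ʳ-injective k _ _ x≡)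

  right-owner : ∀ i j → infOwner 0F i (R j) ≡ spike i j
  right-owner i j rewrite Fin.splitAt-↑ʳ k (k + 0) (j Fin.↑ˡ 0) = refl

  left-owner : ∀ i j → infOwner 0F (next i) (R j ∙ R j) ≡ spike i j
  left-owner i j rewrite R∙R j | Fin.splitAt-↑ˡ k j (k + 0) | prev-next i = refl

-- With an idempotent product the diagonal edges of a column form a triangle, and a triangle has no
-- perfect matching to hand to a point at infinity. Exchanging j and k + j on the way from level 2
-- to level 0 merges two such triangles into a hexagon, which has two perfect matchings, one for
-- each point at infinity. The fixed point `top` keeps its column.
module Twisted (k : ℕ) where
  open OddQuasigroup k public

  top : Fin q
  top = k Fin.↑ʳ (k Fin.↑ʳ 0F)

  data Column : Set where
    left right : Fin k → Column
    middle     : Column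

  column : Fin q → Column
  column x with Fin.splitAt k x
  ... | inj₁ j = left j
  ... | inj₂ y with Fin.splitAt k y
  ... | inj₁ j = right j
  ... | inj₂ _ = middle

  position : Column → Fin q
  position (left j)  = L j
  position (right j) = R j
  position middle    = top

  column-L : ∀ j → column (L j) ≡ left j
  column-L j rewrite Fin.splitAt-↑ˡ k j (k + 1) = refl

  column-R : ∀ j → column (R j) ≡ right j
  column-R j rewrite Fin.splitAt-↑ʳ k (k + 1) (j Fin.↑ˡ 1) | Fin.splitAt-↑ˡ k j 1 = refl

  column-top : column top ≡ middle
  column-top rewrite Fin.splitAt-↑ʳ k (k + 1) (k Fin.↑ʳ 0F) | Fin.splitAt-↑ʳ k 1 0F = refl

  column-position : ∀ c → column (position c) ≡ c
  column-position (left j)  = column-L j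
  column-position (right j) = column-R j
  column-position middle    = column-top

  position-column : ∀ x → position (column x) ≡ x
  position-column x with Fin.splitAt k x in eq
  ... | inj₁ j = Fin.splitAt⁻¹-↑ˡ eq
  ... | inj₂ y with Fin.splitAt k y in eq′
  ... | inj₁ j  = trans (cong (k Fin.↑ʳ_) (Fin.splitAt⁻¹-↑ˡ eq′)) (Fin.splitAt⁻¹-↑ʳ eq)
  ... | inj₂ 0F = trans (cong (k Fin.↑ʳ_) (Fin.splitAt⁻¹-↑ʳ eq′)) (Fin.splitAt⁻¹-↑ʳ eq)

  flip : Column → Column
  flip (left j)  = right j
  flip (right j) = left j
  flip middle    = middle

  flip-flip : ∀ c → flip (flip c) ≡ c
  flip-flip (left j)  = refl
  flip-flip (right j) = refl
  flip-flip middle    = refl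

  α : Fin q → Fin q
  α = position ∘ flip ∘ column

  α-injective : ∀ {x y} → α x ≡ α y → x ≡ y
  α-injective {x} {y} eq = trans (sym (undo x)) (trans (cong α eq) (undo y))
    where
    undo : ∀ x → α (α x) ≡ x
    undo x = trans (cong (position ∘ flip) (column-position (flip (column x))))
      (trans (cong position (flip-flip (column x))) (position-column x))

  op : Fin 3 → Fin q → Fin q → Fin q
  op 2F x y = α (x ∙ y)
  op _  x y = x ∙ y

  op-comm : ∀ i x y → op i x y ≡ op i y x
  op-comm 0F = ∙-comm
  op-comm 1F = ∙-comm
  op-comm 2F x y = cong α (∙-comm x y)

  op-cancel : ∀ i x {y z} → op i x y ≡ op i x z → y ≡ z
  op-cancel 0F x = ∙-cancel x
  op-cancel 1F x = ∙-cancel x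
  op-cancel 2F x = ∙-cancel x ∘ α-injective

  op₂-position : ∀ c → op 2F (position c) (position c) ≡ position (flip c)
  op₂-position c = trans (cong α (idem (position c))) (cong (position ∘ flip) (column-position c))

  position-injective : ∀ {c d} → position c ≡ position d → c ≡ d
  position-injective {c} {d} eq = trans (sym (column-position c)) (trans (cong column eq) (column-position d))

  top-idem : ∀ i → op i top top ≡ top
  top-idem 0F = idem top
  top-idem 1F = idem top
  top-idem 2F = op₂-position middle

  -- Without the main triangles, the columns j and k + j span the hexagon
  -- (0,j) (1,j) (2,j) (0,k+j) (1,k+j) (2,k+j), which the two kinds of spikes split into perfect matchings.
  module Spikes (l : ℕ) (second : Fin (suc l)) (second-unique : ∀ y → second ≡ suc y) where
    open Construction {q} {suc l} op op-comm op-cancel public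

    -- The column where the chosen hexagon edge leaves level i. Point `zero` gets (0, j) (1, j),
    -- then (1, k + j) (2, k + j), then (2, j) (0, k + j); any other point gets the complementary
    -- matching.
    side : Fin (suc l) → Fin 3 → Fin k → Column
    side zero    1F = right
    side zero    _  = left
    side (suc _) 1F = left
    side (suc _) _  = right

    spike : Fin (suc l) → Fin 3 → Fin k → Triangle
    spike y i j = link y i (position (side y i j))

    spikes : List Triangle
    spikes = cartesianProductWith (λ y (i , j) → spike y i j) (allFin (suc l)) (cartesianProduct (allFin 3) (allFin k))

    length-spikes : length spikes ≡ suc l * (3 * k)
    length-spikes = trans (length-cartesianProductWith _ (allFin (suc l)) (cartesianProduct (allFin 3) (allFin k)))
      (cong₂ _*_ (List.length-tabulate {n = suc l} id)
        (trans (length-cartesianProductWith _,_ (allFin 3) (allFin k)) (cong (3 *_) (List.length-tabulate {n = k} id))))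

    side-injective : ∀ y i {j j′} → side y i j ≡ side y i j′ → j ≡ j′
    side-injective zero    0F refl = refl
    side-injective zero    1F refl = refl
    side-injective zero    2F refl = refl
    side-injective (suc _) 0F refl = refl
    side-injective (suc _) 1F refl = refl
    side-injective (suc _) 2F refl = refl

    spike-injective : ∀ {y y′ ij ij′} → spike y (proj₁ ij) (proj₂ ij) ≡ spike y′ (proj₁ ij′) (proj₂ ij′) → y ≡ y′ × ij ≡ ij′
    spike-injective {y} {ij = i , _} eq with refl , refl , x≡ ← link-injective eq =
      refl , cong (i ,_) (side-injective y i (position-injective x≡))

    spikes-Unique : Unique spikes
    spikes-Unique = Unique.cartesianProductWith⁺ _ spike-injective (Unique.allFin⁺ (suc l))
      (Unique.cartesianProduct⁺ (Unique.allFin⁺ 3) (Unique.allFin⁺ k))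

    ∈-spikes⁻ : ∀ {t} → t ∈ spikes → ∃ λ y → ∃ λ i → ∃ λ j → t ≡ spike y i j
    ∈-spikes⁻ t∈ with y , (i , j) , _ , _ , t≡ ← ∈-cartesianProductWith⁻ _ (allFin (suc l)) (cartesianProduct (allFin 3) (allFin k)) t∈ =
      y , i , j , t≡

    spikes-Valid : All Valid spikes
    spikes-Valid = All.tabulate λ t∈ → case ∈-spikes⁻ t∈ of λ { (_ , _ , _ , refl) → tt }

    module _ (apexOwner : Triangle) where

      -- The inverse of `side`: the point at infinity whose matching contains the diagonal edge
      -- leaving level i in the given column.
      apexAt : Fin 3 → Column → Fin (suc l)
      apexAt 1F (left _)  = second
      apexAt 1F _         = zero
      apexAt _  (right _) = second
      apexAt _  _         = zero

      diagOwner : Fin 3 → Fin q → Triangle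
      diagOwner i x with column x
      ... | middle = vert x
      ... | c      = link (apexAt i c) i x

      -- Exchanging the two columns of a hexagon exchanges its two matchings, so that the single
      -- table `spikeAt` serves both.
      mirror : Fin (suc l) → Column → Column
      mirror zero    c = c
      mirror (suc _) c = flip c

      spikeAt : Fin (suc l) → Fin 3 → Column → Triangle
      spikeAt y 2F (left j)  = spike y 2F j
      spikeAt y _  (left j)  = spike y 0F j
      spikeAt y 0F (right j) = spike y 2F j
      spikeAt y _  (right j) = spike y 1F j
      spikeAt y _  middle    = apexOwner

      infOwner : Fin (suc l) → Fin 3 → Fin q → Triangle
      infOwner y i x = spikeAt y i (mirror y (column x))

      open Extras diagOwner infOwner (λ _ → apexOwner) public

      top-Owned : Owned (vert top)
      top-Owned i rewrite column-top = refl

      infOwner-top : ∀ y i → infOwner y i top ≡ apexOwner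
      infOwner-top zero    0F rewrite column-top = refl
      infOwner-top zero    1F rewrite column-top = refl
      infOwner-top zero    2F rewrite column-top = refl
      infOwner-top (suc _) 0F rewrite column-top = refl
      infOwner-top (suc _) 1F rewrite column-top = refl
      infOwner-top (suc _) 2F rewrite column-top = refl

      infOwner-position : ∀ y i c → infOwner y i (position c) ≡ spikeAt y i (mirror y c)
      infOwner-position y i c = cong (spikeAt y i ∘ mirror y) (column-position c)

      diagOwner-spike : ∀ y i j → diagOwner i (position (side y i j)) ≡ spike y i j
      diagOwner-spike zero    0F j rewrite column-L j = refl
      diagOwner-spike zero    1F j rewrite column-R j = refl
      diagOwner-spike zero    2F j rewrite column-L j = refl
      diagOwner-spike (suc y) 0F j rewrite column-R j = cong (λ y → link y 0F (R j)) (second-unique y)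
      diagOwner-spike (suc y) 1F j rewrite column-L j = cong (λ y → link y 1F (L j)) (second-unique y)
      diagOwner-spike (suc y) 2F j rewrite column-R j = cong (λ y → link y 2F (R j)) (second-unique y)

      infOwner-from : ∀ y i j → infOwner y i (position (side y i j)) ≡ spike y i j
      infOwner-from y i j = trans (infOwner-position y i (side y i j)) (table y i)
        where
        table : ∀ y i → spikeAt y i (mirror y (side y i j)) ≡ spike y i j
        table zero    0F = refl
        table zero    1F = refl
        table zero    2F = refl
        table (suc _) 0F = refl
        table (suc _) 1F = refl
        table (suc _) 2F = refl

      infOwner-to : ∀ y i j → let x = position (side y i j) in infOwner y (next i) (op i x x) ≡ spike y i j
      infOwner-to y 0F j = trans (cong (infOwner y 1F) (idem _)) (trans (infOwner-position y 1F (side y 0F j)) (table y))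
        where
        table : ∀ y → spikeAt y 1F (mirror y (side y 0F j)) ≡ spike y 0F j
        table zero    = refl
        table (suc _) = refl
      infOwner-to y 1F j = trans (cong (infOwner y 2F) (idem _)) (trans (infOwner-position y 2F (side y 1F j)) (table y))
        where
        table : ∀ y → spikeAt y 2F (mirror y (side y 1F j)) ≡ spike y 1F j
        table zero    = refl
        table (suc _) = refl
      infOwner-to y 2F j = trans (cong (infOwner y 0F) (op₂-position (side y 2F j)))
          (trans (infOwner-position y 0F (flip (side y 2F j))) (table y))
        where
        table : ∀ y → spikeAt y 0F (mirror y (flip (side y 2F j))) ≡ spike y 2F j
        table zero    = refl
        table (suc _) = refl

      spikes-Owned : All Owned spikes
      spikes-Owned = All.tabulate λ t∈ → case ∈-spikes⁻ t∈ of λ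
        { (y , i , j , refl) → diagOwner-spike y i j , infOwner-from y i j , infOwner-to y i j }

-- The column of `top` is still a triangle and supplies the summand 1; the point at infinity takes
-- one matching of each of the k hexagons.
packing-6k+4 : ∀ k → Packing (3 * (k + (k + 1)) + 1) (3 * ((k + (k + 1)) C 2) + suc (1 * (3 * k)))
packing-6k+4 k = subst (λ l → Packing (3 * q + 1) (3 * (q C 2) + suc l)) length-spikes
  -- As owner of the edges from infinity to the column of `top`, `vert top` is a mere default: these
  -- edges lie in no triangle.
  (construct (vert top) (∉⇒Unique-∷ vert∉ spikes-Unique) (top-idem ∷ spikes-Valid)
    (top-Owned (vert top) ∷ spikes-Owned (vert top)))
  where
  open Twisted k
  -- With a single point at infinity there is no second one, and 0F is a default for the diagonal
  -- edges that no spike uses.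
  open Spikes 0 0F (λ ())
  vert∉ : vert top ∉ spikes
  vert∉ t∈ with _ , _ , _ , () ← ∈-spikes⁻ t∈

-- Both matchings of every hexagon are used. The edge between the two points at infinity goes with
-- (0, `top`) into one more triangle.
packing-6k+5 : ∀ k → Packing (3 * (k + (k + 1)) + 2) (3 * ((k + (k + 1)) C 2) + suc (suc (2 * (3 * k))))
packing-6k+5 k = subst (λ l → Packing (3 * q + 2) (3 * (q C 2) + suc (suc l))) length-spikes
  (construct cap (∉⇒Unique-∷ vert∉ (∉⇒Unique-∷ cap∉ spikes-Unique)) (top-idem ∷ tt ∷ spikes-Valid)
    (top-Owned cap ∷ (refl , infOwner-top cap 0F 0F , infOwner-top cap 1F 0F) ∷ spikes-Owned cap))
  where
  open Twisted k
  1F-unique : ∀ (y : Fin 1) → 1F ≡ suc y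
  1F-unique 0F = refl
  open Spikes 1 1F 1F-unique
  cap : Triangle
  cap = apex (0F , 1F , s≤s z≤n) top
  cap∉ : cap ∉ spikes
  cap∉ t∈ with _ , _ , _ , () ← ∈-spikes⁻ t∈
  vert∉ : vert top ∉ cap ∷ spikes
  vert∉ (there t∈) with _ , _ , _ , () ← ∈-spikes⁻ t∈

-- Counting: the packings reach ⌊(n - 1)²/6⌋ triangles

twice-C2 : ∀ q → 2 * (q C 2) + q ≡ q * q
twice-C2 zero    = refl
twice-C2 (suc q) = begin
  2 * (suc q C 2) + suc q
    ≡⟨ cong (λ b → 2 * b + suc q) (trans (sym (nCk+nC[k+1]≡[n+1]C[k+1] q 1)) (cong (_+ q C 2) (nC1≡n q))) ⟩
  2 * (q + q C 2) + suc q
    ≡⟨ solve 2 (λ q b → con 2 :* (q :+ b) :+ (con 1 :+ q) := (con 2 :* b :+ q) :+ (con 1 :+ (q :+ q))) refl q (q C 2) ⟩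
  (2 * (q C 2) + q) + suc (q + q) ≡⟨ cong (_+ suc (q + q)) (twice-C2 q) ⟩
  q * q + suc (q + q)            ≡⟨ solve 1 (λ q → q :* q :+ (con 1 :+ (q :+ q)) := (con 1 :+ q) :* (con 1 :+ q)) refl q ⟩
  suc q * suc q                  ∎
  where open ≡-Reasoning

-- The inequality says T ≥ ⌊(n - 1)²/6⌋ without a division.
Enough : ℕ → Set
Enough n = Σ ℕ λ T → Packing n T × (n ∸ 1) ^ 2 < 6 * suc T

-- With the gap given explicitly, as `d` + 1, a strict inequality becomes a polynomial identity that
-- the solver can check.
<-by : ∀ {a b} d → a + suc d ≡ b → a < b
<-by {a} d eq = subst (a <_) eq (ℕ.m<m+n a (s≤s z≤n))

-- The binomial disappears through 18 (q C 2) = 9q² - 9q, which leaves a comparison of polynomials.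
packing-bound : ∀ q x {M} → M + 9 * q < 9 * (q * q) + 6 * x + 6 → M < 6 * suc (3 * (q C 2) + x)
packing-bound q x {M} lt = ℕ.+-cancelʳ-< (9 * q) M _ (subst (M + 9 * q <_)
  (trans (cong (λ qq → 9 * qq + 6 * x + 6) (sym (twice-C2 q)))
    (solve 3 (λ b q x → con 9 :* (con 2 :* b :+ q) :+ con 6 :* x :+ con 6 :=
      con 6 :* (con 1 :+ (con 3 :* b :+ x)) :+ con 9 :* q) refl (q C 2) q x)) lt)

enough-from : ∀ {m n} q x → Packing m (3 * (q C 2) + x) → m ≡ n →
  (n ∸ 1) ^ 2 + 9 * q < 9 * (q * q) + 6 * x + 6 → Enough n
enough-from q x pack refl lt = 3 * (q C 2) + x , pack , packing-bound q x lt

enough-6k : ∀ k → Enough (k * 6)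
-- For n = 0 the difference n ∸ 1 is truncated, so the identity for n - 1 = 5 + 6k′ starts at k = 1.
enough-6k zero       = 0 , packing [] [] [] refl , s≤s z≤n
enough-6k k@(suc k′) = enough-from (k + (k + 0)) k (packing-6k k)
  (solve 1 (λ k → con 3 :* (k :+ (k :+ con 0)) :+ con 0 := k :* con 6) refl k)
  (<-by 4 (solve 1 (λ k′ → let k = con 1 :+ k′ ; q = k :+ (k :+ con 0) ; c = con 5 :+ k′ :* con 6 in
    c :* (c :* con 1) :+ con 9 :* q :+ con 5 := con 9 :* (q :* q) :+ con 6 :* k :+ con 6) refl k′))

enough-6k+1 : ∀ k → Enough (1 + k * 6)
enough-6k+1 k = enough-from (k + (k + 0)) (3 * k) (packing-6k+1 k)
  (solve 1 (λ k → con 3 :* (k :+ (k :+ con 0)) :+ con 1 := con 1 :+ k :* con 6) refl k)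
  (<-by 5 (solve 1 (λ k → let q = k :+ (k :+ con 0) ; c = k :* con 6 in
    c :* (c :* con 1) :+ con 9 :* q :+ con 6 := con 9 :* (q :* q) :+ con 6 :* (con 3 :* k) :+ con 6) refl k))

-- Deletion costs at most n/2 triangles; six times that is the additional 3n.
enough-deleted : ∀ {m n} q x → Packing m (3 * (q C 2) + x) → m ≡ suc n →
  (n ∸ 1) ^ 2 + 3 * n + 9 * q < 9 * (q * q) + 6 * x + 6 → Enough n
enough-deleted {n = n} q x pack refl lt with t , pack′ , le ← delete-vertex pack =
  t , pack′ , ℕ.+-cancelʳ-< (3 * n) ((n ∸ 1) ^ 2) (6 * suc t) (ℕ.<-≤-trans (packing-bound q x lt)
    (subst₂ _≤_ (solve 1 (λ T → con 3 :* (con 2 :* T) :+ con 6 := con 6 :* (con 1 :+ T)) refl (3 * (q C 2) + x))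
      (solve 2 (λ t n → con 3 :* (con 2 :* t :+ n) :+ con 6 := con 6 :* (con 1 :+ t) :+ con 3 :* n) refl t n)
      (ℕ.+-monoˡ-≤ 6 (ℕ.*-monoʳ-≤ 3 le))))

enough-6k+2 : ∀ k → Enough (2 + k * 6)
enough-6k+2 k = enough-deleted (k + (k + 1)) (k + (k + 1)) (packing-6k+3 k)
  (solve 1 (λ k → con 3 :* (k :+ (k :+ con 1)) :+ con 0 := con 3 :+ k :* con 6) refl k)
  (<-by 4 (solve 1 (λ k → let q = k :+ (k :+ con 1) ; c = con 1 :+ k :* con 6 in
    c :* (c :* con 1) :+ con 3 :* (con 2 :+ k :* con 6) :+ con 9 :* q :+ con 5 :=
      con 9 :* (q :* q) :+ con 6 :* q :+ con 6) refl k))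

enough-6k+3 : ∀ k → Enough (3 + k * 6)
enough-6k+3 k = enough-from (k + (k + 1)) (k + (k + 1)) (packing-6k+3 k)
  (solve 1 (λ k → con 3 :* (k :+ (k :+ con 1)) :+ con 0 := con 3 :+ k :* con 6) refl k)
  (<-by (6 * k + 7) (solve 1 (λ k → let q = k :+ (k :+ con 1) ; c = con 2 :+ k :* con 6 in
    c :* (c :* con 1) :+ con 9 :* q :+ (con 1 :+ (con 6 :* k :+ con 7)) := con 9 :* (q :* q) :+ con 6 :* q :+ con 6) refl k))

enough-6k+4 : ∀ k → Enough (4 + k * 6)
enough-6k+4 k = enough-from (k + (k + 1)) (suc (1 * (3 * k))) (packing-6k+4 k)
  (solve 1 (λ k → con 3 :* (k :+ (k :+ con 1)) :+ con 1 := con 4 :+ k :* con 6) refl k)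
  (<-by 2 (solve 1 (λ k → let q = k :+ (k :+ con 1) ; c = con 3 :+ k :* con 6 in
    c :* (c :* con 1) :+ con 9 :* q :+ con 3 := con 9 :* (q :* q) :+ con 6 :* (con 1 :+ con 1 :* (con 3 :* k)) :+ con 6) refl k))

enough-6k+5 : ∀ k → Enough (5 + k * 6)
enough-6k+5 k = enough-from (k + (k + 1)) (suc (suc (2 * (3 * k)))) (packing-6k+5 k)
  (solve 1 (λ k → con 3 :* (k :+ (k :+ con 1)) :+ con 2 := con 5 :+ k :* con 6) refl k)
  (<-by (6 * k + 1) (solve 1 (λ k → let q = k :+ (k :+ con 1) ; c = con 4 :+ k :* con 6 in
    c :* (c :* con 1) :+ con 9 :* q :+ (con 1 :+ (con 6 :* k :+ con 1)) :=
      con 9 :* (q :* q) :+ con 6 :* (con 2 :+ con 2 :* (con 3 :* k)) :+ con 6) refl k))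

enough : ∀ n → Enough n
enough n with n divMod 6
... | result k 0F refl = enough-6k k
... | result k 1F refl = enough-6k+1 k
... | result k 2F refl = enough-6k+2 k
... | result k 3F refl = enough-6k+3 k
... | result k 4F refl = enough-6k+4 k
... | result k 5F refl = enough-6k+5 k

packing-exists : ∀ n s → 6 * s ≤ (n ∸ 1) ^ 2 → Packing n s
packing-exists n s le with T , pack , lt ← enough n =
  take-Packing pack (s≤s⁻¹ (ℕ.*-cancelˡ-< 6 s (suc T) (ℕ.≤-<-trans le lt)))

-- The upper bound meets the constructed partitions

Claim : ∀ n k → ℚ → (a b d : ℕ) → Set
Claim n k μ a b d = IsM k n μ × (∀ (c : Edge n → Fin k) → Extremal μ c → PartsMultiset c a b d)

≤1-parity : ∀ a a′ {d d′} → d ≤ 1 → d′ ≤ 1 → 2 * a′ + d′ ≡ 2 * a + d → a′ ≡ a × d′ ≡ d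
≤1-parity a a′ z≤n       z≤n       eq = ℕ.*-cancelˡ-≡ a′ a 2 (ℕ.+-cancelʳ-≡ 0 (2 * a′) (2 * a) eq) , refl
≤1-parity a a′ (s≤s z≤n) (s≤s z≤n) eq = ℕ.*-cancelˡ-≡ a′ a 2 (ℕ.+-cancelʳ-≡ 1 (2 * a′) (2 * a) eq) , refl
≤1-parity a a′ z≤n       (s≤s z≤n) eq =
  contradiction (trans (sym (ℕ.+-identityʳ (2 * a))) (trans (sym eq) (ℕ.+-comm (2 * a′) 1))) (ℕ.even≢odd a a′)
≤1-parity a a′ (s≤s z≤n) z≤n       eq =
  contradiction (trans (sym (ℕ.+-identityʳ (2 * a′))) (trans eq (ℕ.+-comm (2 * a) 1))) (ℕ.even≢odd a′ a)

multiset-cong : ∀ {c : Edge n → Fin k} {a a′ b b′ d d′} → a ≡ a′ → b ≡ b′ → d ≡ d′ →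
  PartsMultiset c a b d → PartsMultiset c a′ b′ d′
multiset-cong refl refl refl parts = parts

module _ {a b d M : ℕ} (d≤1 : d ≤ 1) (parts≡ : a + b + d ≡ k) (total≡ : 3 * a + b + 2 * d ≡ n C 2)
         (M≡ : M + d ≡ 3 * (n C 2) + 3 * k) where

  -- Subtracting the equation for the parts from the one for the edges leaves 2a + d. Its parity
  -- determines d ≤ 1, hence a, and then b follows from the number of parts.
  tally-unique : {c : Edge n → Fin k} {d′ : ℕ} → d′ ≤ 1 → (t : Tally c d′) → Tally.a t ≡ a × Tally.b t ≡ b × d′ ≡ d
  tally-unique {d′ = d′} d′≤1 t = a≡ , b≡ , d≡
    where
    open Tally t renaming (a to a′; b to b′)
    regroup : ∀ a b d → 2 * a + d + (a + b + d) ≡ 3 * a + b + 2 * d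
    regroup = solve 3 (λ a b d → con 2 :* a :+ d :+ (a :+ b :+ d) := con 3 :* a :+ b :+ con 2 :* d) refl
    excess≡ : 2 * a′ + d′ ≡ 2 * a + d
    excess≡ = ℕ.+-cancelʳ-≡ (a + b + d) (2 * a′ + d′) (2 * a + d) (trans
      (cong (_+_ (2 * a′ + d′)) (trans parts≡ (sym parts)))
      (trans (regroup a′ b′ d′) (trans total (trans (sym total≡) (sym (regroup a b d))))))
    a≡ = proj₁ (≤1-parity a a′ d≤1 d′≤1 excess≡)
    d≡ = proj₂ (≤1-parity a a′ d≤1 d′≤1 excess≡)
    b≡ : b′ ≡ b
    b≡ = ℕ.+-cancelˡ-≡ a b′ b (ℕ.+-cancelʳ-≡ d (a + b′) (a + b)
      (trans (cong₂ (λ a d → a + b′ + d) (sym a≡) (sym d≡)) (trans parts (sym parts≡))))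

  claim : HasMadSum n k d → Claim n k (sixth M) a b d
  claim (c , m , mads , W , sum≡ , W≡) =
    ((c , m , mads , trans sum≡ (cong sixth (ℕ.+-cancelʳ-≡ d W M (trans W≡ (sym M≡))))) , upper) , unique
    where
    -- A loss of at most 1 comes with a tally and therefore equals d; any larger loss exceeds d ≤ 1
    -- anyway. For odd t this is where the extra sixth is lost.
    d≤loss : {c : Edge n → Fin k} {d′ : ℕ} → (d′ ≤ 1 → Tally c d′) → d ≤ d′
    d≤loss {d′ = d′} tally with d′ ≤? 1
    ... | yes d′≤1 = ℕ.≤-reflexive (sym (proj₂ (proj₂ (tally-unique d′≤1 (tally d′≤1)))))
    ... | no  d′≰1 = ℕ.≤-trans d≤1 (ℕ.<⇒≤ (ℕ.≰⇒> d′≰1))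

    upper : ∀ c m → MadSum c m → sumℚ m ℚ.≤ sixth M
    upper c m mads = ℚ.≤-trans sum≤ (sixth-mono (ℕ.+-cancelʳ-≤ d U M
      (ℕ.≤-trans (ℕ.+-monoʳ-≤ U (d≤loss tally)) (ℕ.≤-reflexive (trans U+d≡ (sym M≡))))))
      where open Analysis (analyse mads) renaming (d to d′)

    unique : ∀ c → Extremal (sixth M) c → PartsMultiset c a b d
    unique c (m , mads , sum≡) = multiset-cong (proj₁ same) (proj₁ (proj₂ same)) (proj₂ (proj₂ same)) (Tally.multiset (tally d′≤1))
      where
      open Analysis (analyse mads) renaming (d to d′)
      M≤U : M ≤ U
      M≤U = ℕ.*-cancelʳ-≤ M U 6 (fraction-≤⁻ M 5 U 5 (subst (ℚ._≤ sixth U) sum≡ sum≤))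
      -- A partition that attains M has a bound U ≥ M, and U + d′ = M + d then leaves no more than d
      -- for the loss.
      d′≤1 : d′ ≤ 1
      d′≤1 = ℕ.≤-trans (ℕ.+-cancelˡ-≤ M d′ d (ℕ.≤-trans (ℕ.+-monoˡ-≤ d′ M≤U) (ℕ.≤-reflexive (trans U+d≡ (sym M≡))))) d≤1
      same = tally-unique d′≤1 (tally d′≤1)

even-claim : ∀ {s b} → n C 2 ≡ 3 * s + b → Packing n s → Claim n (s + b) (sixth (6 * (2 * s + b))) s b 0
even-claim {n} {s} {b} N≡ (packing ps k3s ps! refl) = claim z≤n (ℕ.+-identityʳ (s + b)) (trans (ℕ.+-identityʳ _) (sym N≡))
  (trans (solve 2 (λ s b → con 6 :* (con 2 :* s :+ b) :+ con 0 := con 3 :* (con 3 :* s :+ b) :+ con 3 :* (s :+ b)) refl s b)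
    (cong (λ N → 3 * N + 3 * (s + b)) (sym N≡)))
  (subst₂ (HasMadSum n) (cong (_+_ s) rest≡) (#P₃-triangles ps k3s) (extend-MadSum ps ps!))
  where
  rest≡ : length (uncovered (allEdges ps)) ≡ b
  rest≡ = ℕ.+-cancelˡ-≡ (3 * s) _ b (trans (cong (_+ length (uncovered (allEdges ps))) (sym (length-allEdges ps k3s)))
    (trans (length-uncovered (allEdges ps) ps!) N≡))

-- The value is 2s + b + 4/3 in sixths. The triangles leave b + 2 edges; the assumption on n finds
-- the P₃ among them, and the remaining b are single parts.
odd-claim : ∀ {s b} → n C 2 ≡ 3 * s + b + 2 → n < 2 * (b + 2) → Packing n s →
  Claim n (s + b + 1) (sixth (2 * (3 * (2 * s + b + 1) + 1))) s b 1
odd-claim {n} {s} {b} N≡ n< (packing ps k3s ps! refl) = claim (s≤s z≤n) refl (sym N≡)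
  (trans (solve 2 (λ s b → con 2 :* (con 3 :* (con 2 :* s :+ b :+ con 1) :+ con 1) :+ con 1 :=
      con 3 :* (con 3 :* s :+ b :+ con 2) :+ con 3 :* (s :+ b :+ con 1)) refl s b)
    (cong (λ N → 3 * N + 3 * (s + b + 1)) (sym N≡)))
  (subst₂ (HasMadSum n) parts≡ (cong suc (#P₃-triangles ps k3s)) (extend-MadSum (path ∷ ps) pps!))
  where
  es = allEdges ps
  rest≡ : length (uncovered es) ≡ b + 2
  rest≡ = ℕ.+-cancelˡ-≡ (3 * s) _ (b + 2) (trans (cong (_+ length (uncovered es)) (sym (length-allEdges ps k3s)))
    (trans (length-uncovered es ps!) (trans N≡ (ℕ.+-assoc (3 * s) b 2))))

  found : Path (uncovered es)
  found = path-exists (uncovered es) (uncovered-Unique es) (subst (λ r → n < 2 * r) (sym rest≡) n<)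

  e = proj₁ found
  f = proj₁ (proj₂ found)
  e∈ = proj₁ (proj₂ (proj₂ found))
  f∈ = proj₁ (proj₂ (proj₂ (proj₂ found)))
  e≢f = proj₁ (proj₂ (proj₂ (proj₂ (proj₂ found))))

  path : Piece n
  path = record { pieceEdges = e ∷ f ∷ [] ; shape = p3 ; isShape = proj₂ (proj₂ (proj₂ (proj₂ (proj₂ found)))) }

  pps! : Unique (e ∷ f ∷ es)
  pps! = ∉⇒Unique-∷ (λ { (here e≡f) → e≢f e≡f ; (there e∈es) → ∈-uncovered⁻ es e∈ e∈es })
    (∉⇒Unique-∷ (∈-uncovered⁻ es f∈) ps!)

  parts≡ : suc s + length (uncovered (allEdges (path ∷ ps))) ≡ s + b + 1
  parts≡ = trans (cong (_+_ (suc s)) rest′≡) (solve 2 (λ s b → con 1 :+ s :+ b := s :+ b :+ con 1) refl s b)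
    where
    rest′≡ : length (uncovered (allEdges (path ∷ ps))) ≡ b
    rest′≡ = ℕ.+-cancelˡ-≡ (2 + 3 * s) _ b (trans
      (cong (λ l → 2 + l + length (uncovered (allEdges (path ∷ ps)))) (sym (length-allEdges ps k3s)))
      (trans (length-uncovered (allEdges (path ∷ ps)) pps!) (trans N≡ (ℕ.+-comm (3 * s + b) 2))))

twice-C2-suc : ∀ c → 2 * (suc c C 2) ≡ c ^ 2 + c
twice-C2-suc c = ℕ.+-cancelʳ-≡ (suc c) (2 * (suc c C 2)) (c ^ 2 + c) (trans (twice-C2 (suc c))
  (solve 1 (λ c → (con 1 :+ c) :* (con 1 :+ c) := c :* (c :* con 1) :+ c :+ (con 1 :+ c)) refl c))

-- Keeps N ∸ 3s from being truncated: 6s = 3t ≤ (n - 1)² ≤ n(n - 1) = 2N.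
even-room : ∀ n s → 3 ≤ n → 3 * (2 * s) ≤ (n ∸ 1) ^ 2 → 3 * s ≤ n C 2
even-room (suc c) s _ le = ℕ.*-cancelˡ-≤ 2 (begin
  2 * (3 * s)        ≡⟨ solve 1 (λ s → con 2 :* (con 3 :* s) := con 3 :* (con 2 :* s)) refl s ⟩
  3 * (2 * s)        ≤⟨ le ⟩
  c ^ 2              ≤⟨ ℕ.m≤m+n (c ^ 2) c ⟩
  c ^ 2 + c          ≡⟨ twice-C2-suc c ⟨
  2 * (suc c C 2)    ∎)
  where open ℕ.≤-Reasoning

-- Here 3t = 6s + 3, and n(n - 1) exceeds (n - 1)² by n - 1. So at least (n + 2)/2 edges remain
-- beside s triangles, more than a matching can have.
odd-room : ∀ n s → 3 ≤ n → 3 * (2 * s + 1) ≤ (n ∸ 1) ^ 2 → 6 * s + n + 2 ≤ 2 * (n C 2)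
odd-room (suc c) s _ le = begin
  6 * s + suc c + 2      ≡⟨ solve 2 (λ s c → con 6 :* s :+ (con 1 :+ c) :+ con 2 := con 3 :* (con 2 :* s :+ con 1) :+ c) refl s c ⟩
  3 * (2 * s + 1) + c    ≤⟨ ℕ.+-monoˡ-≤ c le ⟩
  c ^ 2 + c              ≡⟨ twice-C2-suc c ⟨
  2 * (suc c C 2)        ∎
  where open ℕ.≤-Reasoning

theorem5p4 : ∀ (n t : ℕ) → 3 ≤ n → 3 * t ≤ (n ∸ 1) ^ 2 →
    (∀ (s : ℕ) → t ≡ 2 * s →
    IsM ((n C 2) ∸ t) n ((+ ((n C 2) ∸ s)) / 1) ×
    (∀ (c : Edge n → Fin ((n C 2) ∸ t)) → Extremal ((+ ((n C 2) ∸ s)) / 1) c →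
    PartsMultiset c s ((n C 2) ∸ 3 * s) 0)) ×
    (∀ (s : ℕ) → t ≡ 2 * s + 1 →
    IsM ((n C 2) ∸ t) n ((+ (3 * ((n C 2) ∸ (s + 1)) + 1)) / 3) ×
    (∀ (c : Edge n → Fin ((n C 2) ∸ t)) → Extremal ((+ (3 * ((n C 2) ∸ (s + 1)) + 1)) / 3) c →
    PartsMultiset c s ((n C 2) ∸ 2 ∸ 3 * s) 1))
theorem5p4 n t 3≤n le = even′ , odd′
  where
  N = n C 2

  ∸-by : ∀ {m} a b → m ≡ a + b → m ∸ a ≡ b
  ∸-by a b refl = ℕ.m+n∸m≡n a b

  even′ : ∀ s → t ≡ 2 * s → Claim n (N ∸ t) (+ (N ∸ s) / 1) s (N ∸ 3 * s) 0
  even′ s refl = subst₂ (λ k X → Claim n k (+ X / 1) s b 0)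
    (sym (∸-by (2 * s) (s + b) (trans N≡ (solve 2 (λ s b → con 3 :* s :+ b := con 2 :* s :+ (s :+ b)) refl s b))))
    (sym (∸-by s (2 * s + b) (trans N≡ (solve 2 (λ s b → con 3 :* s :+ b := s :+ (con 2 :* s :+ b)) refl s b))))
    (subst (λ μ → Claim n (s + b) μ s b 0) (fraction-≡ (6 * (2 * s + b)) 5 (2 * s + b) 0
        (trans (ℕ.*-identityʳ _) (ℕ.*-comm 6 (2 * s + b))))
      (even-claim N≡ (packing-exists n s (subst (_≤ (n ∸ 1) ^ 2) (sym (ℕ.*-assoc 3 2 s)) le))))
    where
    b = N ∸ 3 * s
    N≡ : N ≡ 3 * s + b
    N≡ = sym (ℕ.m+[n∸m]≡n (even-room n s 3≤n le))

  odd′ : ∀ s → t ≡ 2 * s + 1 → Claim n (N ∸ t) (+ (3 * (N ∸ (s + 1)) + 1) / 3) s (N ∸ 2 ∸ 3 * s) 1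
  odd′ s refl = subst₂ (λ k X → Claim n k (+ (3 * X + 1) / 3) s b 1)
    (sym (∸-by (2 * s + 1) (s + b + 1) (trans N≡
      (solve 2 (λ s b → con 3 :* s :+ b :+ con 2 := con 2 :* s :+ con 1 :+ (s :+ b :+ con 1)) refl s b))))
    (sym (∸-by (s + 1) (2 * s + b + 1) (trans N≡
      (solve 2 (λ s b → con 3 :* s :+ b :+ con 2 := s :+ con 1 :+ (con 2 :* s :+ b :+ con 1)) refl s b))))
    (subst (λ μ → Claim n (s + b + 1) μ s b 1) (fraction-≡ (2 * Y) 5 Y 2
        (solve 1 (λ Y → con 2 :* Y :* con 3 := Y :* con 6) refl Y))
      (odd-claim N≡ n< (packing-exists n s (ℕ.≤-trans (ℕ.≤-trans (ℕ.m≤m+n (6 * s) 3)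
        (ℕ.≤-reflexive (solve 1 (λ s → con 6 :* s :+ con 3 := con 3 :* (con 2 :* s :+ con 1)) refl s))) le))))
    where
    open ℕ.≤-Reasoning
    b = N ∸ 2 ∸ 3 * s
    Y = 3 * (2 * s + b + 1) + 1

    room : 2 + 3 * s ≤ N
    room = ℕ.*-cancelˡ-≤ 2 (begin
      2 * (2 + 3 * s)    ≡⟨ solve 1 (λ s → con 2 :* (con 2 :+ con 3 :* s) := con 6 :* s :+ con 2 :+ con 2) refl s ⟩
      6 * s + 2 + 2      ≤⟨ ℕ.+-monoˡ-≤ 2 (ℕ.+-monoʳ-≤ (6 * s) (ℕ.≤-trans (s≤s (s≤s z≤n)) 3≤n)) ⟩
      6 * s + n + 2      ≤⟨ odd-room n s 3≤n le ⟩
      2 * N              ∎)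

    N≡ : N ≡ 3 * s + b + 2
    N≡ = trans (sym (ℕ.m+[n∸m]≡n room)) (trans (cong (_+_ (2 + 3 * s)) (sym (ℕ.∸-+-assoc N 2 (3 * s))))
      (solve 2 (λ s b → con 2 :+ con 3 :* s :+ b := con 3 :* s :+ b :+ con 2) refl s b))

    n< : n < 2 * (b + 2)
    n< = ℕ.+-cancelˡ-≤ (6 * s) (suc n) (2 * (b + 2)) (begin
      6 * s + suc n          ≤⟨ ℕ.m≤m+n (6 * s + suc n) 1 ⟩
      6 * s + suc n + 1      ≡⟨ solve 2 (λ s n → con 6 :* s :+ (con 1 :+ n) :+ con 1 := con 6 :* s :+ n :+ con 2) refl s n ⟩
      6 * s + n + 2          ≤⟨ odd-room n s 3≤n le ⟩
      2 * N                  ≡⟨ cong (2 *_) N≡ ⟩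
      2 * (3 * s + b + 2)    ≡⟨ solve 2 (λ s b → con 2 :* (con 3 :* s :+ b :+ con 2) := con 6 :* s :+ con 2 :* (b :+ con 2)) refl s b ⟩
      6 * s + 2 * (b + 2)    ∎)
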